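{- Let $B$ be the adjacency matrix of a regular graph $G_B$ on $4$ vertices. For each $n$, let $C_n$ be the adjacency matrix of a graph $G_{C_n}$ on $n$ vertices which has minimum degree at least $1$ (resp. at least $2$). Call a $4\times n$ $0$-$1$ matrix $N$ GM-admissible if each of its columns has exactly $0$, $2$ or $4$ ones. For such $N$, let $G$ be the labeled graph with adjacency matrix $\begin{bmatrix} B & N \\ N^t & C_n\end{bmatrix}$ and $\tilde G$ the labeled graph with adjacency matrix $\begin{bmatrix} B & \tilde N \\ \tilde N^t & C_n\end{bmatrix}$, where $\tilde N$ is obtained from $N$ by replacing each column $\mathbf v$ containing exactly two ones by $\mathbf{1}-\mathbf v$. Then the proportion of GM-admissible $N$ (among all $8^n$ of them) for which $Z_{G^*}\ne Z_{\tilde G^*}$ (resp. $Z_G \ne Z_{\tilde G}$) tends to $1$ as $n\to\infty$.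
   Context: Graphs are finite and simple. $Z_G$ denotes the Ihara zeta function: for a graph $G$ with adjacency matrix $A$, degree matrix $D$, $n_G$ vertices and $m_G$ edges, $Z_G(t)=(1-t^2)^{n_G-m_G}\det(I-tA+t^2(D-I))^{ -1}$; equivalently $Z_G(t)=\prod_{[\gamma]}(1-t^{\ell(\gamma)})^{ -1}$ over cyclic-rotation classes of primitive closed geodesics $\gamma$ (closed walks without backtracking $e_{i+1}= e_i^{ -1}$ and without tail $e_1=e_\ell^{ -1}$, not a power of a shorter one). The cone $G^*$ is $G$ together with a new vertex adjacent to every vertex of $G$. -}

module Defs where

open import Algebra.Bundles.Raw using (RawRing)
import Algebra.Definitions.RawSemiring as RawSemiringDefs
open import Data.Bool using (Bool; true; false; _∧_; if_then_else_)
open import Data.Fin using (Fin; zero; suc; toℕ; punchIn; splitAt)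
import Data.Fin.Properties as Fin
open import Data.Fin.Subset using (Subset; ∁; ∣_∣)
open import Data.Integer as ℤ using (ℤ; +_; 0ℤ; 1ℤ)
import Data.Integer.Properties as ℤ
open import Data.List using (List; []; _∷_; length; filter; map; cartesianProductWith)
open import Data.List.Properties using (length-++; filter-++)
open import Data.Nat as ℕ using (ℕ; zero; suc; _∸_; _≤_; NonZero)
import Data.Nat.Properties as ℕ
open import Data.Product using (_×_; _,_; ∃-syntax)
open import Data.Rational as ℚ using (ℚ; 0ℚ)
open import Data.Sum using (_⊎_; inj₁; inj₂)
open import Data.Vec as Vec using (Vec; []; _∷_; lookup; tabulate)
open import Data.Vec.Relation.Unary.All as All using (All; []; _∷_)
open import Function using (_∘_)
open import Level using (0ℓ)
open import Relation.Binary.PropositionalEquality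
open import Relation.Nullary using (Dec; yes; no; does; ¬_)
open import Relation.Nullary.Decidable using (map′; ¬?; _×-dec_; _⊎-dec_)
open import Relation.Unary using (Pred; Decidable)

-- Coefficient lists, constant term first; trailing zeros are allowed, so
-- equality is equality of all coefficients.

Poly : Set
Poly = List ℤ

coeff : Poly → ℕ → ℤ
coeff []      _       = 0ℤ
coeff (a ∷ p) zero    = a
coeff (a ∷ p) (suc k) = coeff p k

infix 4 _≈ₚ_ _≈ₚ?_

_≈ₚ_ : Poly → Poly → Set
p ≈ₚ q = ∀ k → coeff p k ≡ coeff q k

_≈ₚ?_ : ∀ p q → Dec (p ≈ₚ q)
[]      ≈ₚ? []      = yes λ _ → refl
[]      ≈ₚ? (b ∷ q) =
  map′ (λ { (e , f) zero → e ; (e , f) (suc k) → f k })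
       (λ f → f 0 , f ∘ suc) ((0ℤ ℤ.≟ b) ×-dec ([] ≈ₚ? q))
(a ∷ p) ≈ₚ? []      =
  map′ (λ { (e , f) zero → e ; (e , f) (suc k) → f k })
       (λ f → f 0 , f ∘ suc) ((a ℤ.≟ 0ℤ) ×-dec (p ≈ₚ? []))
(a ∷ p) ≈ₚ? (b ∷ q) =
  map′ (λ { (e , f) zero → e ; (e , f) (suc k) → f k })
       (λ f → f 0 , f ∘ suc) ((a ℤ.≟ b) ×-dec (p ≈ₚ? q))

infixl 6 _+ₚ_
infixl 7 _*ₚ_

_+ₚ_ : Poly → Poly → Poly
[]      +ₚ q       = q
(a ∷ p) +ₚ []      = a ∷ p
(a ∷ p) +ₚ (b ∷ q) = (a ℤ.+ b) ∷ (p +ₚ q)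

-ₚ_ : Poly → Poly
-ₚ_ = map (λ a → ℤ.- a)

_*ₚ_ : Poly → Poly → Poly
[]      *ₚ q = []
(a ∷ p) *ₚ q = map (a ℤ.*_) q +ₚ (0ℤ ∷ (p *ₚ q))

polyRawRing : RawRing 0ℓ 0ℓ
polyRawRing = record
  { Carrier = Poly
  ; _≈_     = _≈ₚ_
  ; _+_     = _+ₚ_
  ; _*_     = _*ₚ_
  ; -_      = -ₚ_
  ; 0#      = []
  ; 1#      = 1ℤ ∷ []
  }

open RawSemiringDefs (RawRing.rawSemiring polyRawRing)
  using () renaming (_^_ to _^ₚ_) public

Matrix : ∀ {c} → Set c → ℕ → Set c
Matrix A n = Fin n → Fin n → A

module Determinant {c ℓ} (R : RawRing c ℓ) where
  open RawRing R
  open RawSemiringDefs rawSemiring using (sum; _^_)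

  det : ∀ {n} → Matrix Carrier n → Carrier
  det {zero}  M = 1#
  det {suc n} M =
    sum λ j → ((- 1#) ^ toℕ j) * M zero j * det (λ i k → M (suc i) (punchIn j k))

open Determinant polyRawRing public using () renaming (det to detₚ)

-- Fractions of polynomials over ℤ; up to _≈_ these are the elements of ℚ(t).

record RationalFunction : Set where
  field
    num   : Poly
    den   : Poly
    den≢0 : ¬ (den ≈ₚ [])

open RationalFunction public

infix 4 _≈_ _≉_ _≈?_ _≉?_

_≈_ _≉_ : RationalFunction → RationalFunction → Set
f ≈ g = num f *ₚ den g ≈ₚ num g *ₚ den f
f ≉ g = ¬ (f ≈ g)

_≈?_ : ∀ f g → Dec (f ≈ g)
f ≈? g = num f *ₚ den g ≈ₚ? num g *ₚ den f

_≉?_ : ∀ f g → Dec (f ≉ g)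
f ≉? g = ¬? (f ≈? g)

record Graph (n : ℕ) : Set where
  field
    adj    : Fin n → Fin n → Bool
    symm   : ∀ i j → adj i j ≡ adj j i
    irrefl : ∀ i → adj i i ≡ false

open Graph public

neighbours : ∀ {n} → Graph n → Fin n → Subset n
neighbours G i = tabulate (adj G i)

degree : ∀ {n} → Graph n → Fin n → ℕ
degree G i = ∣ neighbours G i ∣

-- Each edge {i , j} is counted once, at its smaller endpoint.
numEdges : ∀ {n} → Graph n → ℕ
numEdges G =
  Vec.sum (tabulate λ i → ∣ tabulate (λ j → adj G i j ∧ (toℕ i ℕ.<ᵇ toℕ j)) ∣)

Regular : ∀ {n} → Graph n → Set
Regular G = ∃[ r ] ∀ i → degree G i ≡ r

-- Satisfiable for n > d (and n = 0) only: there is no simple graph of minimum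
-- degree d on 1 ≤ n ≤ d vertices.
MinDegree≥ : ∀ {n} → ℕ → Graph n → Set
MinDegree≥ d G = ∀ i → d ≤ degree G i

cone : ∀ {n} → Graph n → Graph (suc n)
cone {n} G = record { adj = a ; symm = s ; irrefl = r }
  where
  a : Fin (suc n) → Fin (suc n) → Bool
  a zero    zero    = false
  a zero    (suc j) = true
  a (suc i) zero    = true
  a (suc i) (suc j) = adj G i j

  s : ∀ i j → a i j ≡ a j i
  s zero    zero    = refl
  s zero    (suc j) = refl
  s (suc i) zero    = refl
  s (suc i) (suc j) = symm G i j

  r : ∀ i → a i i ≡ false
  r zero    = refl
  r (suc i) = irrefl G i

⟦_⟧ : Bool → ℤ
⟦ b ⟧ = if b then 1ℤ else 0ℤ

identity : ∀ {n} → Matrix ℤ n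
identity i j = ⟦ does (i Fin.≟ j) ⟧

adjacencyMatrix degreeMatrix : ∀ {n} → Graph n → Matrix ℤ n
adjacencyMatrix G i j = ⟦ adj G i j ⟧
degreeMatrix    G i j = identity i j ℤ.* (+ degree G i)

-- I − tA + t²(D − I), entrywise as coefficient lists in t.
iharaMatrix : ∀ {n} → Graph n → Matrix Poly n
iharaMatrix G i j =
    identity i j
  ∷ ℤ.- adjacencyMatrix G i j
  ∷ degreeMatrix G i j ℤ.- identity i j
  ∷ []

1-t² : Poly
1-t² = 1ℤ ∷ 0ℤ ∷ ℤ.-1ℤ ∷ []

constantTerm : Poly → ℤ
constantTerm p = coeff p 0

constantTerm-+ : ∀ p q → constantTerm (p +ₚ q) ≡ constantTerm p ℤ.+ constantTerm q
constantTerm-+ []      q       = sym (ℤ.+-identityˡ _)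
constantTerm-+ (a ∷ p) []      = sym (ℤ.+-identityʳ _)
constantTerm-+ (a ∷ p) (b ∷ q) = refl

constantTerm-* : ∀ p q → constantTerm (p *ₚ q) ≡ constantTerm p ℤ.* constantTerm q
constantTerm-* []      q       = refl
constantTerm-* (a ∷ p) []      = sym (ℤ.*-zeroʳ a)
constantTerm-* (a ∷ p) (b ∷ q) = ℤ.+-identityʳ _

constantTerm-^ : ∀ p k → constantTerm p ≡ 1ℤ → constantTerm (p ^ₚ k) ≡ 1ℤ
constantTerm-^ p zero    e = refl
constantTerm-^ p (suc k) e =
  trans (constantTerm-* p (p ^ₚ k)) (cong₂ ℤ._*_ e (constantTerm-^ p k e))

open RawSemiringDefs (RawRing.rawSemiring polyRawRing) using (sum)

constantTerm-sum : ∀ {n} (f : Fin n → Poly) →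
                   (∀ i → constantTerm (f i) ≡ 0ℤ) → constantTerm (sum f) ≡ 0ℤ
constantTerm-sum {zero}  f e = refl
constantTerm-sum {suc n} f e =
  trans (constantTerm-+ (f zero) _) (cong₂ ℤ._+_ (e zero) (constantTerm-sum (f ∘ suc) (e ∘ suc)))

constantTerm-term : ∀ s p d {a b c} → constantTerm s ≡ a → constantTerm p ≡ b → constantTerm d ≡ c →
                    constantTerm (s *ₚ p *ₚ d) ≡ a ℤ.* b ℤ.* c
constantTerm-term s p d ea eb ec =
  trans (constantTerm-* (s *ₚ p) d) (cong₂ ℤ._*_ (trans (constantTerm-* s p) (cong₂ ℤ._*_ ea eb)) ec)

constantTerm-det : ∀ {n} (M : Matrix Poly n) →
                   (∀ i j → constantTerm (M i j) ≡ identity i j) → constantTerm (detₚ M) ≡ 1ℤ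
constantTerm-det {zero}  M e = refl
constantTerm-det {suc n} M e =
  trans (constantTerm-+ (term zero) _)
        (cong₂ ℤ._+_ first (constantTerm-sum (term ∘ suc) rest))
  where
  minor : Fin (suc n) → Matrix Poly n
  minor j i k = M (suc i) (punchIn j k)

  sign : Fin (suc n) → Poly
  sign j = (-ₚ (1ℤ ∷ [])) ^ₚ toℕ j

  term : Fin (suc n) → Poly
  term j = sign j *ₚ M zero j *ₚ detₚ (minor j)

  first : constantTerm (term zero) ≡ 1ℤ
  first = constantTerm-term (sign zero) (M zero zero) (detₚ (minor zero)) refl (e zero zero)
            (constantTerm-det (minor zero) λ i j → e (suc i) (suc j))

  rest : ∀ j → constantTerm (term (suc j)) ≡ 0ℤ
  rest j = trans
    (constantTerm-term (sign (suc j)) (M zero (suc j)) (detₚ (minor (suc j)))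
                refl (e zero (suc j)) refl)
    (cong (ℤ._* constantTerm (detₚ (minor (suc j)))) (ℤ.*-zeroʳ (constantTerm (sign (suc j)))))

-- The exponent n − m of 1 − t² may have either sign: its positive part goes
-- to the numerator, its negative part to the denominator.
Z : ∀ {n} → Graph n → RationalFunction
Z {n} G = record
  { num   = 1-t² ^ₚ (n ∸ m)
  ; den   = 1-t² ^ₚ (m ∸ n) *ₚ detₚ (iharaMatrix G)
  ; den≢0 = λ den≈0 → 1≢0 (trans (sym constantTerm-den) (den≈0 0))
  }
  where
  m : ℕ
  m = numEdges G

  1≢0 : 1ℤ ≢ 0ℤ
  1≢0 ()

  constantTerm-den : constantTerm (1-t² ^ₚ (m ∸ n) *ₚ detₚ (iharaMatrix G)) ≡ 1ℤ
  constantTerm-den = trans (constantTerm-* (1-t² ^ₚ (m ∸ n)) (detₚ (iharaMatrix G)))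
                           (cong₂ ℤ._*_ (constantTerm-^ 1-t² (m ∸ n) refl)
                                        (constantTerm-det (iharaMatrix G) λ _ _ → refl))

-- A 4 × n matrix with 0-1 entries is the vector of its n columns.
Matrix4× : ℕ → Set
Matrix4× n = Vec (Subset 4) n

AdmissibleColumn : Pred (Subset 4) 0ℓ
AdmissibleColumn v = ∣ v ∣ ≡ 0 ⊎ ∣ v ∣ ≡ 2 ⊎ ∣ v ∣ ≡ 4

admissibleColumn? : Decidable AdmissibleColumn
admissibleColumn? v = (∣ v ∣ ℕ.≟ 0) ⊎-dec ((∣ v ∣ ℕ.≟ 2) ⊎-dec (∣ v ∣ ℕ.≟ 4))

GMAdmissible : ∀ {n} → Pred (Matrix4× n) 0ℓ
GMAdmissible = All AdmissibleColumn

gmAdmissible? : ∀ {n} → Decidable (GMAdmissible {n})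
gmAdmissible? = All.all? admissibleColumn?

switchColumn : Subset 4 → Subset 4
switchColumn v = if does (∣ v ∣ ℕ.≟ 2) then ∁ v else v

switch : ∀ {n} → Matrix4× n → Matrix4× n
switch = Vec.map switchColumn

-- The graph with adjacency matrix [ B N ; Nᵗ C ].
block : ∀ {n} → Graph 4 → Matrix4× n → Graph n → Graph (4 ℕ.+ n)
block {n} B N C = record
  { adj    = λ i j → a (splitAt 4 i) (splitAt 4 j)
  ; symm   = λ i j → s (splitAt 4 i) (splitAt 4 j)
  ; irrefl = λ i → r (splitAt 4 i)
  }
  where
  a : Fin 4 ⊎ Fin n → Fin 4 ⊎ Fin n → Bool
  a (inj₁ i) (inj₁ j) = adj B i j
  a (inj₁ i) (inj₂ j) = lookup (lookup N j) i
  a (inj₂ i) (inj₁ j) = lookup (lookup N i) j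
  a (inj₂ i) (inj₂ j) = adj C i j

  s : ∀ x y → a x y ≡ a y x
  s (inj₁ i) (inj₁ j) = symm B i j
  s (inj₁ i) (inj₂ j) = refl
  s (inj₂ i) (inj₁ j) = refl
  s (inj₂ i) (inj₂ j) = symm C i j

  r : ∀ x → a x x ≡ false
  r (inj₁ i) = irrefl B i
  r (inj₂ i) = irrefl C i

allVecs : ∀ {A : Set} → List A → ∀ n → List (Vec A n)
allVecs xs zero    = [] ∷ []
allVecs xs (suc n) = cartesianProductWith _∷_ xs (allVecs xs n)

allMatrices : ∀ n → List (Matrix4× n)
allMatrices = allVecs (allVecs (false ∷ true ∷ []) 4)

admissibleMatrices : ∀ n → List (Matrix4× n)
admissibleMatrices n = filter gmAdmissible? (allMatrices n)

module _ {A : Set} {P : Pred A 0ℓ} (P? : Decidable P) where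

  length-filter-∷ : ∀ {n} x (vs : List (Vec A n)) →
    length (filter (All.all? P?) (map (x ∷_) vs)) ≡
    (if does (P? x) then length (filter (All.all? P?) vs) else 0)
  length-filter-∷ x [] with P? x
  ... | yes _ = refl
  ... | no  _ = refl
  length-filter-∷ x (v ∷ vs) with P? x | All.all? P? v | length-filter-∷ x vs
  ... | yes _ | yes _ | ih = cong suc ih
  ... | yes _ | no  _ | ih = ih
  ... | no  _ | _     | ih = ih

  length-filter-× : ∀ {n} xs (vs : List (Vec A n)) →
    length (filter (All.all? P?) (cartesianProductWith _∷_ xs vs)) ≡
    length (filter P? xs) ℕ.* length (filter (All.all? P?) vs)
  length-filter-× []       vs = refl
  length-filter-× (x ∷ xs) vs
    rewrite filter-++ (All.all? P?) (map (x ∷_) vs) (cartesianProductWith _∷_ xs vs)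
          | length-++ (filter (All.all? P?) (map (x ∷_) vs))
                      {filter (All.all? P?) (cartesianProductWith _∷_ xs vs)}
          | length-filter-∷ x vs
          | length-filter-× xs vs
    with P? x
  ... | yes _ = refl
  ... | no  _ = refl

  length-filter-allVecs : ∀ xs n →
    length (filter (All.all? P?) (allVecs xs n)) ≡ length (filter P? xs) ℕ.^ n
  length-filter-allVecs xs zero    = refl
  length-filter-allVecs xs (suc n) =
    trans (length-filter-× xs (allVecs xs n))
          (cong (length (filter P? xs) ℕ.*_) (length-filter-allVecs xs n))

length-admissibleMatrices : ∀ n → length (admissibleMatrices n) ≡ 8 ℕ.^ n
length-admissibleMatrices =
  length-filter-allVecs admissibleColumn? (allVecs (false ∷ true ∷ []) 4)

admissibleMatrices-nonZero : ∀ n → NonZero (length (admissibleMatrices n))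
admissibleMatrices-nonZero n =
  subst NonZero (sym (length-admissibleMatrices n)) (ℕ.m^n≢0 8 n)

proportionOfAdmissible : ∀ n {P : Pred (Matrix4× n) 0ℓ} → Decidable P → ℚ
proportionOfAdmissible n P? =
  ℚ._/_ (+ length (filter P? (admissibleMatrices n))) (length (admissibleMatrices n))
        {{admissibleMatrices-nonZero n}}

_TendsTo_ : (ℕ → ℚ) → ℚ → Set
a TendsTo L = ∀ ε → 0ℚ ℚ.< ε → ∃[ n₀ ] (∀ n → n₀ ≤ n → ℚ.∣ a n ℚ.- L ∣ ℚ.< ε)

module Submission where

-- Up to sign, ∏ᵢ (dᵢ − 1) over the vertex degrees dᵢ is the leading coefficient
-- of the polynomial (1 − t²)^(m−n) det(I − tA + t²(D − I)).  Switching preserves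
-- the number of edges and all degrees outside B, where the factors are nonzero, so
-- equal zeta functions give ∏ (c + xᵢ) = ∏ (c + yᵢ) over the four vertices of B,
-- where xᵢ and yᵢ are the row sums of N and Ñ.  As xᵢ + yᵢ does not depend on i
-- and Σ xᵢ = Σ yᵢ, the difference of the two products is
-- (2c + x₀ + y₀)(x₁ − y₀)(x₂ − y₀)(x₃ − y₀), and one deduces xᵢ = y₀ for some i ≥ 1.
-- For random N the difference xᵢ − y₀ is a lazy random walk.  Its probability of
-- being at 0 after n steps is nonincreasing in n, and by Tanaka's formula its sum
-- over time is proportional to the mean distance from 0, which is O(√n) by the
-- second moment; hence this probability is O(1/√n).

open import Defs
open import Data.Nat using (ℕ; _<_)
open import Data.Product using (_×_)
open import Data.Rational using (1ℚ)

open import Algebra.Bundles.Raw using (RawRing)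
import Algebra.Definitions.RawSemiring as RawSemiringDefs
open import Data.Bool using (Bool; true; false; _∧_; if_then_else_; T)
open import Data.Bool.Properties using (∧-identityʳ; ∧-zeroʳ)
open import Data.Fin using (Fin; zero; suc; toℕ; punchIn; _↑ˡ_; _↑ʳ_; fromℕ<)
open import Data.Fin.Patterns using (0F; 1F; 2F; 3F)
import Data.Fin.Properties as Fin
open import Data.Fin.Subset using (Subset; ∣_∣)
open import Data.Fin.Subset.Properties using (∣∁p∣≡n∸∣p∣)
open import Data.Integer as ℤ using (ℤ; +_; -[1+_]; 0ℤ; 1ℤ; -1ℤ)
import Data.Integer.Properties as ℤ
import Data.Integer.Tactic.RingSolver as ℤ
open import Data.List using (List; []; _∷_; _++_; length; filter; map; cartesianProductWith)
open import Data.List.Membership.Propositional using (_∈_)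
open import Data.List.Membership.Propositional.Properties using (∈-cartesianProductWith⁺)
open import Data.List.Properties using (filter-++; map-++; map-∘; map-cong; length-filter)
import Data.List.Relation.Unary.All as ListAll
open import Data.List.Relation.Unary.All.Properties using (all-filter)
open import Data.List.Relation.Unary.Any using (here; there)
open import Data.Nat as ℕ using (zero; suc; _+_; _*_; _^_; _∸_; _≤_; z≤n; s≤s; ∣_-_∣; NonZero)
open import Data.Nat.ListAction using (sum)
open import Data.Nat.ListAction.Properties using (sum-++)
import Data.Nat.Properties as ℕ
open import Data.Nat.Tactic.RingSolver using (solve-∀)
open import Data.Product using (_,_; ∃; proj₂)
open import Data.Rational as ℚ using (0ℚ)
import Data.Rational.Properties as ℚ
import Data.Rational.Unnormalised as ℚᵘ
import Data.Rational.Unnormalised.Properties as ℚᵘ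
open import Data.Sum as Sum using (_⊎_; [_,_]′)
open import Data.Unit using (tt)
open import Data.Vec as Vec using (Vec; []; _∷_; lookup; tabulate)
import Data.Vec.Functional as Vector
open import Data.Vec.Properties using (tabulate∘lookup; tabulate-cong; lookup-map)
open import Data.Vec.Relation.Unary.All as All using (All; []; _∷_)
open import Function using (_∘_)
open import Level using (0ℓ)
open import Relation.Binary.PropositionalEquality
open import Relation.Nullary using (yes; no; does; ¬_)
open import Relation.Nullary.Decidable using (_→-dec_; _⊎-dec_; from-yes; decidable-stable)
open import Relation.Unary using (Pred; Decidable)

open RawSemiringDefs (RawRing.rawSemiring polyRawRing) using () renaming (sum to sumₚ)

-- Leading coefficients

-- Top d c p: p has degree at most d, and c (possibly 0) is its coefficient of t^d.
Top : ℕ → ℤ → Poly → Set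
Top d c p = ∀ k → coeff p (d ℕ.+ k) ≡ coeff (c ∷ []) k

coeff-+ : ∀ p q k → coeff (p +ₚ q) k ≡ coeff p k ℤ.+ coeff q k
coeff-+ []      q       k       = sym (ℤ.+-identityˡ _)
coeff-+ (a ∷ p) []      k       = sym (ℤ.+-identityʳ _)
coeff-+ (a ∷ p) (b ∷ q) zero    = refl
coeff-+ (a ∷ p) (b ∷ q) (suc k) = coeff-+ p q k

coeff-scale : ∀ a p k → coeff (map (a ℤ.*_) p) k ≡ a ℤ.* coeff p k
coeff-scale a []      k       = sym (ℤ.*-zeroʳ a)
coeff-scale a (b ∷ p) zero    = refl
coeff-scale a (b ∷ p) (suc k) = coeff-scale a p k

-- Trailing zeros are allowed, so a zero polynomial need not be the empty list and its products do
-- not vanish by computation alone.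
*ₚ-zeroˡ : ∀ p q → p ≈ₚ [] → p *ₚ q ≈ₚ []
*ₚ-zeroˡ []      q p≈0 k = refl
*ₚ-zeroˡ (a ∷ p) q p≈0 k = trans (coeff-+ (map (a ℤ.*_) q) _ k) (cong₂ ℤ._+_ scaled (shifted k))
  where
  scaled : coeff (map (a ℤ.*_) q) k ≡ 0ℤ
  scaled = trans (coeff-scale a q k) (cong (ℤ._* coeff q k) (p≈0 0))

  shifted : 0ℤ ∷ (p *ₚ q) ≈ₚ []
  shifted zero    = refl
  shifted (suc k) = *ₚ-zeroˡ p q (p≈0 ∘ suc) k

Top-coeff : ∀ {d c} p → Top d c p → coeff p d ≡ c
Top-coeff {d} p t = trans (cong (coeff p) (sym (ℕ.+-identityʳ d))) (t 0)

Top-+ : ∀ {d a b} p q → Top d a p → Top d b q → Top d (a ℤ.+ b) (p +ₚ q)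
Top-+ {d} p q s t k = trans (coeff-+ p q (d ℕ.+ k)) (trans (cong₂ ℤ._+_ (s k) (t k)) (constants k))
  where
  constants : ∀ {a b} k → coeff (a ∷ []) k ℤ.+ coeff (b ∷ []) k ≡ coeff (a ℤ.+ b ∷ []) k
  constants zero    = refl
  constants (suc k) = refl

Top-scale : ∀ a {d c} p → Top d c p → Top d (a ℤ.* c) (map (a ℤ.*_) p)
Top-scale a {d} {c} p t k = trans (coeff-scale a p (d ℕ.+ k)) (trans (cong (a ℤ.*_) (t k)) (constant k))
  where
  constant : ∀ k → a ℤ.* coeff (c ∷ []) k ≡ coeff (a ℤ.* c ∷ []) k
  constant zero    = refl
  constant (suc k) = ℤ.*-zeroʳ a

Top-raise : ∀ {d c} e p → Top d c p → Top (suc e ℕ.+ d) 0ℤ p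
Top-raise {d} e p t k = trans (cong (coeff p) shift) (trans (t (suc e ℕ.+ k)) (zeros k))
  where
  shift : suc e ℕ.+ d ℕ.+ k ≡ d ℕ.+ (suc e ℕ.+ k)
  shift = trans (cong (ℕ._+ k) (ℕ.+-comm (suc e) d)) (ℕ.+-assoc d (suc e) k)

  zeros : ∀ k → 0ℤ ≡ coeff (0ℤ ∷ []) k
  zeros zero    = refl
  zeros (suc k) = refl

-- Induction along `p` and its degree bound. At bound 0 the tail of `p` is zero and only the
-- constant term contributes; at a positive bound the constant term times `q` stays below the top
-- degree, which is reached only through the tail.
Top-* : ∀ {d e a b} p q → Top d a p → Top e b q → Top (d ℕ.+ e) (a ℤ.* b) (p *ₚ q)
Top-* {a = a} {b} [] q s t zero    = trans (sym (ℤ.*-zeroˡ b)) (cong (ℤ._* b) (s 0))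
Top-*             [] q s t (suc k) = refl
Top-* {zero} {e} {a} {b} (a₀ ∷ p) q s t =
  subst (λ c → Top e c ((a₀ ∷ p) *ₚ q))
        (trans (ℤ.+-identityʳ _) (cong (ℤ._* b) (s 0)))
        (Top-+ (map (a₀ ℤ.*_) q) _ (Top-scale a₀ q t) vanishing)
  where
  vanishing : Top e 0ℤ (0ℤ ∷ (p *ₚ q))
  vanishing k = trans (shifted (e ℕ.+ k)) (zeros k)
    where
    shifted : 0ℤ ∷ (p *ₚ q) ≈ₚ []
    shifted zero    = refl
    shifted (suc k) = *ₚ-zeroˡ p q (s ∘ suc) k

    zeros : ∀ k → 0ℤ ≡ coeff (0ℤ ∷ []) k
    zeros zero    = refl
    zeros (suc k) = refl
Top-* {suc d} {e} {a} {b} (a₀ ∷ p) q s t =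
  subst (λ c → Top (suc d ℕ.+ e) c ((a₀ ∷ p) *ₚ q))
        (trans (cong (ℤ._+ a ℤ.* b) (ℤ.*-zeroʳ a₀)) (ℤ.+-identityˡ _))
        (Top-+ {suc (d ℕ.+ e)} (map (a₀ ℤ.*_) q) _ (Top-scale a₀ {suc d ℕ.+ e} q (Top-raise d q t)) (Top-* p q s t))

Top-1 : Top 0 1ℤ (1ℤ ∷ [])
Top-1 k = refl

Top-^ : ∀ {d c} p k → Top d c p → Top (k ℕ.* d) (c ℤ.^ k) (p ^ₚ k)
Top-^ p zero    t = Top-1
Top-^ p (suc k) t = Top-* p (p ^ₚ k) t (Top-^ p k t)

Top-sum-0 : ∀ {n d} (f : Fin n → Poly) → (∀ i → Top d 0ℤ (f i)) → Top d 0ℤ (sumₚ f)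
Top-sum-0 {zero}  f t zero    = refl
Top-sum-0 {zero}  f t (suc k) = refl
Top-sum-0 {suc n} f t = Top-+ (f zero) _ (t zero) (Top-sum-0 (f ∘ suc) (t ∘ suc))

module _ {n} (M : Matrix Poly (suc n)) where
  minor : Fin (suc n) → Matrix Poly n
  minor j i k = M (suc i) (punchIn j k)

  -- The summand in the definition of `detₚ`, so that `detₚ M` unfolds to `sumₚ (laplaceTerm M)`.
  laplaceTerm : Fin (suc n) → Poly
  laplaceTerm j = (-ₚ (1ℤ ∷ [])) ^ₚ toℕ j *ₚ M zero j *ₚ detₚ (minor j)

  Top-laplaceTerm : ∀ {a b d} j → Top 2 a (M zero j) → Top d b (detₚ (minor j)) →
                    Top (2 ℕ.+ d) (-1ℤ ℤ.^ toℕ j ℤ.* a ℤ.* b) (laplaceTerm j)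
  Top-laplaceTerm {a} {d = d} j s t =
    Top-* {2} {d} (sign *ₚ M zero j) (detₚ (minor j)) (Top-* {0} {2} sign (M zero j) Top-sign s) t
    where
    sign : Poly
    sign = (-ₚ (1ℤ ∷ [])) ^ₚ toℕ j

    Top-sign : Top 0 (-1ℤ ℤ.^ toℕ j) sign
    Top-sign = subst (λ e → Top e (-1ℤ ℤ.^ toℕ j) sign) (ℕ.*-zeroʳ (toℕ j)) (Top-^ (ℤ.-1ℤ ∷ []) (toℕ j) (λ k → refl))

Top-sum : ∀ {n d} (f : Fin n → Poly) → (∀ i → ∃ λ c → Top d c (f i)) → ∃ λ c → Top d c (sumₚ f)
Top-sum {zero}  {d} f t = 0ℤ , Top-sum-0 {d = d} f λ ()
Top-sum {suc n} {d} f t = _ , Top-+ {d} (f zero) _ (proj₂ (t zero)) (proj₂ (Top-sum {d = d} (f ∘ suc) (t ∘ suc)))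

-- A mere degree bound suffices for the off-diagonal minors: they get multiplied by an entry whose
-- `t²` coefficient is 0, so their own top coefficients need not be known.
Top-det : ∀ {n} (M : Matrix Poly n) → (∀ i j → ∃ λ c → Top 2 c (M i j)) →
          ∃ λ c → Top (n ℕ.* 2) c (detₚ M)
Top-det {zero}  M t = 1ℤ , Top-1
Top-det {suc n} M t = Top-sum {d = suc n ℕ.* 2} (laplaceTerm M) λ j → _ ,
  Top-laplaceTerm M {d = n ℕ.* 2} j (proj₂ (t zero j)) (proj₂ (Top-det (minor M j) λ i k → t (suc i) (punchIn j k)))

product : ∀ {n} → (Fin n → ℤ) → ℤ
product = Vector.foldr ℤ._*_ 1ℤ

-- The `t²` coefficients form a diagonal matrix, so in the expansion along row 0 only the first term
-- reaches the top degree.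
Top-det-diagonal : ∀ {n} (M : Matrix Poly n) (d : Fin n → ℤ) →
                   (∀ i j → Top 2 (identity i j ℤ.* d i) (M i j)) →
                   Top (n ℕ.* 2) (product d) (detₚ M)
Top-det-diagonal {zero}  M d t = Top-1
Top-det-diagonal {suc n} M d t =
  subst (λ c → Top (suc n ℕ.* 2) c (detₚ M)) value
    (Top-+ {suc n ℕ.* 2} (laplaceTerm M zero) _
      (Top-laplaceTerm M {d = n ℕ.* 2} zero (t zero zero)
        (Top-det-diagonal (minor M zero) (d ∘ suc) λ i j → t (suc i) (suc j)))
      (Top-sum-0 {d = suc n ℕ.* 2} (laplaceTerm M ∘ suc) offDiagonal))
  where
  value : 1ℤ ℤ.* (1ℤ ℤ.* d zero) ℤ.* product (d ∘ suc) ℤ.+ 0ℤ ≡ product d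
  value = trans (ℤ.+-identityʳ (1ℤ ℤ.* (1ℤ ℤ.* d zero) ℤ.* product (d ∘ suc)))
    (cong (ℤ._* product (d ∘ suc)) (trans (ℤ.*-identityˡ (1ℤ ℤ.* d zero)) (ℤ.*-identityˡ (d zero))))

  offDiagonal : ∀ j → Top (suc n ℕ.* 2) 0ℤ (laplaceTerm M (suc j))
  offDiagonal j with c , top ← Top-det (minor M (suc j)) (λ i k → _ , t (suc i) (punchIn (suc j) k)) =
    subst (λ c → Top (suc n ℕ.* 2) c (laplaceTerm M (suc j)))
      (trans (cong (ℤ._* c) (ℤ.*-zeroʳ (-1ℤ ℤ.^ suc (toℕ j)))) (ℤ.*-zeroˡ c))
      (Top-laplaceTerm M {d = n ℕ.* 2} (suc j) (t zero (suc j)) top)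

-- Zeta functions and vertex degrees

excess : ∀ {n} → Graph n → Fin n → ℤ
excess G i = + degree G i ℤ.- 1ℤ

Top-iharaMatrix : ∀ {n} (G : Graph n) i j → Top 2 (identity i j ℤ.* excess G i) (iharaMatrix G i j)
Top-iharaMatrix G i j (suc k) = refl
Top-iharaMatrix G i j zero    = sym (trans (ℤ.*-distribˡ-+ δ (+ (degree G i)) -1ℤ)
  (cong (λ x → δ ℤ.* (+ degree G i) ℤ.+ x) (trans (sym (ℤ.neg-distribʳ-* δ 1ℤ)) (cong ℤ.-_ (ℤ.*-identityʳ δ)))))
  where
  δ : ℤ
  δ = identity i j

module _ (k l d : ℕ) where

  Top-crossProduct : ∀ p {c} → Top d c p →
    Top (k ℕ.* 2 ℕ.+ (l ℕ.* 2 ℕ.+ d)) (-1ℤ ℤ.^ k ℤ.* (-1ℤ ℤ.^ l ℤ.* c)) (1-t² ^ₚ k *ₚ (1-t² ^ₚ l *ₚ p))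
  Top-crossProduct p t = Top-* {k ℕ.* 2} {l ℕ.* 2 ℕ.+ d} (1-t² ^ₚ k) (1-t² ^ₚ l *ₚ p) (Top-^ 1-t² k (λ j → refl))
    (Top-* {l ℕ.* 2} {d} (1-t² ^ₚ l) p (Top-^ 1-t² l (λ j → refl)) t)

  -- `1-t²` has leading coefficient -1, so the common factor contributes only a sign, which cancels.
  -- As `d` merely bounds the degrees, `a` and `b` may be 0.
  topCoefficients-≡ : ∀ p q {a b} → Top d a p → Top d b q →
    1-t² ^ₚ k *ₚ (1-t² ^ₚ l *ₚ p) ≈ₚ 1-t² ^ₚ k *ₚ (1-t² ^ₚ l *ₚ q) → a ≡ b
  topCoefficients-≡ p q {a} {b} s t e = cancel l (cancel k (begin
    -1ℤ ℤ.^ k ℤ.* (-1ℤ ℤ.^ l ℤ.* a)  ≡⟨ Top-coeff (1-t² ^ₚ k *ₚ (1-t² ^ₚ l *ₚ p)) (Top-crossProduct p s) ⟨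
    _                                ≡⟨ e (k ℕ.* 2 ℕ.+ (l ℕ.* 2 ℕ.+ d)) ⟩
    _                                ≡⟨ Top-coeff (1-t² ^ₚ k *ₚ (1-t² ^ₚ l *ₚ q)) (Top-crossProduct q t) ⟩
    -1ℤ ℤ.^ k ℤ.* (-1ℤ ℤ.^ l ℤ.* b)  ∎))
    where
    open ≡-Reasoning

    cancel : ∀ j {x y} → -1ℤ ℤ.^ j ℤ.* x ≡ -1ℤ ℤ.^ j ℤ.* y → x ≡ y
    cancel j {x} {y} = ℤ.*-cancelˡ-≡ (-1ℤ ℤ.^ j) x y {{ℤ.≢-nonZero λ e → -1≢0 (ℤ.i^n≡0⇒i≡0 -1ℤ j e)}}
      where
      -1≢0 : -1ℤ ≢ 0ℤ
      -1≢0 ()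

-- With equally many edges, cross-multiplying puts the same powers of `1-t²` on both sides, and only
-- the determinants remain to be compared.
Z≈⇒product-excess-≡ : ∀ {n} (G H : Graph n) → numEdges G ≡ numEdges H → Z G ≈ Z H →
                      product (excess G) ≡ product (excess H)
-- Cross-multiplication pairs the numerator of `Z G` with the determinant of `H`, so the equation
-- arrives reversed.
Z≈⇒product-excess-≡ {n} G H m≡m′ Z≈ =
  sym (topCoefficients-≡ (n ∸ numEdges G) (numEdges G ∸ n) (n ℕ.* 2) (detₚ (iharaMatrix H)) (detₚ (iharaMatrix G))
    (top H) (top G)
    (subst (λ m → 1-t² ^ₚ (n ∸ numEdges G) *ₚ (1-t² ^ₚ (m ∸ n) *ₚ detₚ (iharaMatrix H)) ≈ₚ
                  1-t² ^ₚ (n ∸ m) *ₚ (1-t² ^ₚ (numEdges G ∸ n) *ₚ detₚ (iharaMatrix G)))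
           (sym m≡m′) Z≈))
  where
  top : ∀ (K : Graph n) → Top (n ℕ.* 2) (product (excess K)) (detₚ (iharaMatrix K))
  top K = Top-det-diagonal (iharaMatrix K) (excess K) (Top-iharaMatrix K)

-- The lazy random walk

-- One step of the walk on ℤ that moves by −1, 0, +1 with weights 1, 6, 1,
-- acting on even functions, which are represented by their values on ℕ.
step : (ℕ → ℕ) → ℕ → ℕ
step F zero    = 6 * F 0 + 2 * F 1
step F (suc v) = F v + 6 * F (suc v) + F (suc (suc v))

steps : ℕ → (ℕ → ℕ) → ℕ → ℕ
steps zero    F = F
steps (suc n) F = step (steps n F)

-- Moves the latest step next to `F`, where the identities for a single step of a test function
-- apply.
steps-step : ∀ n F → steps n (step F) ≡ step (steps n F)
steps-step zero    F = refl
steps-step (suc n) F = cong step (steps-step n F)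

steps-mono : ∀ n {F G} → (∀ v → F v ≤ G v) → ∀ v → steps n F v ≤ steps n G v
steps-mono zero    F≤G v       = F≤G v
steps-mono (suc n) F≤G zero    =
  ℕ.+-mono-≤ (ℕ.*-monoʳ-≤ 6 (steps-mono n F≤G 0)) (ℕ.*-monoʳ-≤ 2 (steps-mono n F≤G 1))
steps-mono (suc n) F≤G (suc v) =
  ℕ.+-mono-≤ (ℕ.+-mono-≤ (steps-mono n F≤G v) (ℕ.*-monoʳ-≤ 6 (steps-mono n F≤G (suc v))))
             (steps-mono n F≤G (suc (suc v)))

-- A multiple of a single function is treated below as a two-term combination with second
-- coefficient 0.
steps-linear : ∀ n a b F G v →
               steps n (λ u → a * F u + b * G u) v ≡ a * steps n F v + b * steps n G v
steps-linear zero    a b F G v       = refl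
steps-linear (suc n) a b F G zero
  rewrite steps-linear n a b F G 0 | steps-linear n a b F G 1 =
  rearrange a b (steps n F 0) (steps n F 1) (steps n G 0) (steps n G 1)
  where
  rearrange : ∀ a b x y u w → 6 * (a * x + b * u) + 2 * (a * y + b * w) ≡
                              a * (6 * x + 2 * y) + b * (6 * u + 2 * w)
  rearrange = solve-∀
steps-linear (suc n) a b F G (suc v)
  rewrite steps-linear n a b F G v | steps-linear n a b F G (suc v) | steps-linear n a b F G (suc (suc v)) =
  rearrange a b (steps n F v) (steps n F (suc v)) (steps n F (suc (suc v)))
                (steps n G v) (steps n G (suc v)) (steps n G (suc (suc v)))
  where
  rearrange : ∀ a b x y z u w t → (a * x + b * u) + 6 * (a * y + b * w) + (a * z + b * t) ≡
                                  a * (x + 6 * y + z) + b * (u + 6 * w + t)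
  rearrange = solve-∀

steps-cong : ∀ n {F G} → F ≗ G → steps n F ≗ steps n G
steps-cong n F≗G v =
  ℕ.≤-antisym (steps-mono n (ℕ.≤-reflexive ∘ F≗G) v) (steps-mono n (ℕ.≤-reflexive ∘ sym ∘ F≗G) v)

-- `steps n F 0` is `8 ^ n` times the expectation of `F` at the distance from 0 after n steps of the
-- walk started at 0. These test functions yield the total weight, the visits to 0 and the second
-- moment.
one δ₀ square : ℕ → ℕ
one    v       = 1
δ₀     zero    = 1
δ₀     (suc v) = 0
square v       = v * v

steps-one : ∀ n → steps n one 0 ≡ 8 ^ n
steps-one zero    = refl
steps-one (suc n) = begin
  steps (suc n) one 0                      ≡⟨ cong (λ F → F 0) (steps-step n one) ⟨
  steps n (step one) 0                     ≡⟨ steps-cong n step-one 0 ⟩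
  steps n (λ v → 8 * one v + 0 * one v) 0  ≡⟨ steps-linear n 8 0 one one 0 ⟩
  8 * steps n one 0 + 0                    ≡⟨ ℕ.+-identityʳ (8 * steps n one 0) ⟩
  8 * steps n one 0                        ≡⟨ cong (8 *_) (steps-one n) ⟩
  8 ^ suc n                                ∎
  where
  open ≡-Reasoning

  step-one : step one ≗ λ v → 8 * one v + 0 * one v
  step-one zero    = refl
  step-one (suc v) = refl

-- Tanaka's formula: the increments of the mean distance from 0 count the visits to 0.
distance-suc : ∀ n → steps (suc n) (λ v → v) 0 ≡ 8 * steps n (λ v → v) 0 + 2 * steps n δ₀ 0
distance-suc n = begin
  steps (suc n) (λ v → v) 0                     ≡⟨ cong (λ F → F 0) (steps-step n (λ v → v)) ⟨
  steps n (step (λ v → v)) 0                    ≡⟨ steps-cong n step-id 0 ⟩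
  steps n (λ v → 8 * v + 2 * δ₀ v) 0            ≡⟨ steps-linear n 8 2 (λ v → v) δ₀ 0 ⟩
  8 * steps n (λ v → v) 0 + 2 * steps n δ₀ 0    ∎
  where
  open ≡-Reasoning

  rearrange : ∀ v → v + 6 * suc v + suc (suc v) ≡ 8 * suc v + 0
  rearrange = solve-∀

  step-id : step (λ v → v) ≗ λ v → 8 * v + 2 * δ₀ v
  step-id zero    = refl
  step-id (suc v) = rearrange v

-- A step has variance 2/8, so the second moment after n steps is n/4.
4*steps-square : ∀ n → 4 * steps n square 0 ≡ n * 8 ^ n
4*steps-square zero    = refl
4*steps-square (suc n) = begin
  4 * steps (suc n) square 0                         ≡⟨ cong (λ F → 4 * F 0) (steps-step n square) ⟨
  4 * steps n (step square) 0                        ≡⟨ cong (4 *_) (steps-cong n step-square 0) ⟩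
  4 * steps n (λ v → 8 * square v + 2 * one v) 0     ≡⟨ cong (4 *_) (steps-linear n 8 2 square one 0) ⟩
  4 * (8 * steps n square 0 + 2 * steps n one 0)     ≡⟨ rearrange (steps n square 0) (steps n one 0) ⟩
  8 * (4 * steps n square 0) + 8 * steps n one 0     ≡⟨ cong₂ (λ x y → 8 * x + 8 * y) (4*steps-square n) (steps-one n) ⟩
  8 * (n * 8 ^ n) + 8 * 8 ^ n                        ≡⟨ collect n (8 ^ n) ⟩
  suc n * 8 ^ suc n                                  ∎
  where
  open ≡-Reasoning

  rearrange : ∀ x y → 4 * (8 * x + 2 * y) ≡ 8 * (4 * x) + 8 * y
  rearrange = solve-∀

  collect : ∀ n x → 8 * (n * x) + 8 * x ≡ suc n * (8 * x)
  collect = solve-∀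

  expand : ∀ v → v * v + 6 * (suc v * suc v) + suc (suc v) * suc (suc v) ≡ 8 * (suc v * suc v) + 2 * 1
  expand = solve-∀

  step-square : step square ≗ λ v → 8 * square v + 2 * one v
  step-square zero    = refl
  step-square (suc v) = expand v

Antitone : (ℕ → ℕ) → Set
Antitone F = ∀ v → F (suc v) ≤ F v

-- The critical comparison is between 0 and 1, and it rests on laziness: the weight 6 of staying is
-- at least the weight 1 of a move. Without rests it would fail by parity.
step-antitone : ∀ {F} → Antitone F → Antitone (step F)
step-antitone {F} F↓ zero = begin
  F 0 + 6 * F 1 + F 2            ≤⟨ ℕ.+-monoʳ-≤ (F 0 + 6 * F 1) (F↓ 1) ⟩
  F 0 + 6 * F 1 + F 1            ≡⟨ split (F 0) (F 1) ⟩
  F 0 + 5 * F 1 + 2 * F 1        ≤⟨ ℕ.+-monoˡ-≤ (2 * F 1) (ℕ.+-monoʳ-≤ (F 0) (ℕ.*-monoʳ-≤ 5 (F↓ 0))) ⟩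
  6 * F 0 + 2 * F 1              ∎
  where
  open ℕ.≤-Reasoning

  split : ∀ x y → x + 6 * y + y ≡ x + 5 * y + 2 * y
  split = solve-∀
step-antitone F↓ (suc v) =
  ℕ.+-mono-≤ (ℕ.+-mono-≤ (F↓ v) (ℕ.*-monoʳ-≤ 6 (F↓ (suc v)))) (F↓ (suc (suc v)))

steps-δ₀-antitone : ∀ n → Antitone (steps n δ₀)
steps-δ₀-antitone zero    v = z≤n
steps-δ₀-antitone (suc n)   = step-antitone (steps-δ₀-antitone n)

-- After division by `8 ^ suc n`: the return probability does not increase, since the chance of
-- hitting 0 is largest from 0 itself.
visits-suc : ∀ n → steps (suc n) δ₀ 0 ≤ 8 * steps n δ₀ 0
visits-suc n = begin
  6 * F 0 + 2 * F 1  ≤⟨ ℕ.+-monoʳ-≤ (6 * F 0) (ℕ.*-monoʳ-≤ 2 (steps-δ₀-antitone n 0)) ⟩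
  6 * F 0 + 2 * F 0  ≡⟨ ℕ.*-distribʳ-+ (F 0) 6 2 ⟨
  8 * F 0            ∎
  where
  open ℕ.≤-Reasoning

  F : ℕ → ℕ
  F = steps n δ₀

-- By Tanaka's formula the mean distance is a quarter of the sum of the return probabilities at
-- times 0, ..., n - 1, each of which is at least the one at time n.
n*visits≤4*distance : ∀ n → n * steps n δ₀ 0 ≤ 4 * steps n (λ v → v) 0
n*visits≤4*distance zero    = z≤n
n*visits≤4*distance (suc n) = begin
  suc n * steps (suc n) δ₀ 0   ≤⟨ ℕ.*-monoʳ-≤ (suc n) (visits-suc n) ⟩
  suc n * (8 * d)              ≡⟨ expand n d ⟩
  8 * (n * d) + 8 * d          ≤⟨ ℕ.+-monoˡ-≤ (8 * d) (ℕ.*-monoʳ-≤ 8 (n*visits≤4*distance n)) ⟩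
  8 * (4 * a) + 8 * d          ≡⟨ collect a d ⟩
  4 * (8 * a + 2 * d)          ≡⟨ cong (4 *_) (distance-suc n) ⟨
  4 * steps (suc n) (λ v → v) 0 ∎
  where
  open ℕ.≤-Reasoning

  a d : ℕ
  a = steps n (λ v → v) 0
  d = steps n δ₀ 0

  expand : ∀ n d → suc n * (8 * d) ≡ 8 * (n * d) + 8 * d
  expand = solve-∀

  collect : ∀ a d → 8 * (4 * a) + 8 * d ≡ 4 * (8 * a + 2 * d)
  collect = solve-∀

-- The two sides differ by (m - n)², which is unchanged when both numbers drop by 1.
2*m*n≤m²+n² : ∀ m n → 2 * (m * n) ≤ m * m + n * n
2*m*n≤m²+n² zero    n       = z≤n
2*m*n≤m²+n² (suc m) zero    = ℕ.≤-trans (ℕ.≤-reflexive (cong (2 *_) (ℕ.*-zeroʳ m))) z≤n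
2*m*n≤m²+n² (suc m) (suc n) = begin
  2 * (suc m * suc n)                        ≡⟨ left m n ⟩
  2 * (m * n) + (2 * m + 2 * n + 2)          ≤⟨ ℕ.+-monoˡ-≤ (2 * m + 2 * n + 2) (2*m*n≤m²+n² m n) ⟩
  m * m + n * n + (2 * m + 2 * n + 2)        ≡⟨ right m n ⟩
  suc m * suc m + suc n * suc n              ∎
  where
  open ℕ.≤-Reasoning

  left : ∀ m n → 2 * (suc m * suc n) ≡ 2 * (m * n) + (2 * m + 2 * n + 2)
  left = solve-∀

  right : ∀ m n → m * m + n * n + (2 * m + 2 * n + 2) ≡ suc m * suc m + suc n * suc n
  right = solve-∀

-- Replaces the Cauchy-Schwarz bound on the mean distance E without square roots: averaging 2kv ≤ v²
-- + k² gives 2kE ≤ n/4 + k², which is at most n/2 once 4k² ≤ n.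
distance-bound : ∀ k n → 4 * (k * k) ≤ n → 4 * k * steps n (λ v → v) 0 ≤ n * 8 ^ n
distance-bound k n 4k²≤n = ℕ.*-cancelˡ-≤ 2 (begin
  2 * (4 * k * a)                         ≡⟨ left k a ⟩
  4 * (2 * k * a + 0 * a)                 ≡⟨ cong (4 *_) (steps-linear n (2 * k) 0 (λ v → v) (λ v → v) 0) ⟨
  4 * steps n (λ v → 2 * k * v + 0 * v) 0 ≤⟨ ℕ.*-monoʳ-≤ 4 (steps-mono n am-gm 0) ⟩
  4 * steps n (λ v → 1 * square v + k * k * one v) 0
                                          ≡⟨ cong (4 *_) (steps-linear n 1 (k * k) square one 0) ⟩
  4 * (1 * s + k * k * steps n one 0)     ≡⟨ middle k s (steps n one 0) ⟩
  4 * s + 4 * (k * k) * steps n one 0     ≡⟨ cong₂ (λ x y → x + 4 * (k * k) * y) (4*steps-square n) (steps-one n) ⟩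
  n * 8 ^ n + 4 * (k * k) * 8 ^ n         ≤⟨ ℕ.+-monoʳ-≤ (n * 8 ^ n) (ℕ.*-monoˡ-≤ (8 ^ n) 4k²≤n) ⟩
  n * 8 ^ n + n * 8 ^ n                   ≡⟨ cong (λ z → n * 8 ^ n + z) (ℕ.+-identityʳ (n * 8 ^ n)) ⟨
  2 * (n * 8 ^ n)                         ∎)
  where
  open ℕ.≤-Reasoning

  a s : ℕ
  a = steps n (λ v → v) 0
  s = steps n square 0

  left : ∀ k a → 2 * (4 * k * a) ≡ 4 * (2 * k * a + 0 * a)
  left = solve-∀

  middle : ∀ k s e → 4 * (1 * s + k * k * e) ≡ 4 * s + 4 * (k * k) * e
  middle = solve-∀

  am-gm : ∀ v → 2 * k * v + 0 * v ≤ 1 * square v + k * k * one v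
  am-gm v = begin
    2 * k * v + 0              ≡⟨ rearrangeˡ k v ⟩
    2 * (v * k)                ≤⟨ 2*m*n≤m²+n² v k ⟩
    v * v + k * k              ≡⟨ rearrangeʳ k v ⟩
    1 * square v + k * k * 1   ∎
    where
    rearrangeˡ : ∀ k v → 2 * k * v + 0 ≡ 2 * (v * k)
    rearrangeˡ = solve-∀

    rearrangeʳ : ∀ k v → v * v + k * k ≡ 1 * (v * v) + k * k * 1
    rearrangeʳ = solve-∀

-- The O(1/√n) bound in integer form: the return probability is at most 1/k as soon as n ≥ 4k².
visits-bound : ∀ k n .{{_ : NonZero n}} → 4 * (k * k) ≤ n → k * steps n δ₀ 0 ≤ 8 ^ n
visits-bound k n 4k²≤n = ℕ.*-cancelˡ-≤ n (begin
  n * (k * d)   ≡⟨ left n k d ⟩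
  k * (n * d)   ≤⟨ ℕ.*-monoʳ-≤ k (n*visits≤4*distance n) ⟩
  k * (4 * a)   ≡⟨ right k a ⟩
  4 * k * a     ≤⟨ distance-bound k n 4k²≤n ⟩
  n * 8 ^ n     ∎)
  where
  open ℕ.≤-Reasoning

  a d : ℕ
  a = steps n (λ v → v) 0
  d = steps n δ₀ 0

  left : ∀ n k d → n * (k * d) ≡ k * (n * d)
  left = solve-∀

  right : ∀ k a → k * (4 * a) ≡ 4 * k * a
  right = solve-∀

-- Row sums of a random admissible matrix

indicator : Bool → ℕ
indicator b = if b then 1 else 0

row : ∀ {n} → Fin 4 → Matrix4× n → Subset n
row i N = tabulate λ j → lookup (lookup N j) i

rowSum : ∀ {n} → Fin 4 → Matrix4× n → ℕ
rowSum i N = ∣ row i N ∣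

rowSum-∷ : ∀ {n} i v (N : Matrix4× n) → rowSum i (v ∷ N) ≡ indicator (lookup v i) + rowSum i N
rowSum-∷ i v N with lookup v i
... | true  = refl
... | false = refl

admissibleColumns : List (Subset 4)
admissibleColumns = filter admissibleColumn? (allVecs (false ∷ true ∷ []) 4)

module _ {A : Set} {P : Pred A 0ℓ} (P? : Decidable P) where

  filter-map-∷ : ∀ {n} x (vs : List (Vec A n)) →
    filter (All.all? P?) (map (x ∷_) vs) ≡
    (if does (P? x) then map (x ∷_) (filter (All.all? P?) vs) else [])
  filter-map-∷ x [] with P? x
  ... | yes _ = refl
  ... | no  _ = refl
  filter-map-∷ x (v ∷ vs) with P? x | All.all? P? v | filter-map-∷ x vs
  ... | yes _ | yes _ | ih = cong ((x ∷ v) ∷_) ih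
  ... | yes _ | no  _ | ih = ih
  ... | no  _ | _     | ih = ih

  -- Admissibility constrains each column separately, so the columns of a random admissible matrix
  -- are independent and uniform. Summing over these matrices needs the list itself, beyond its
  -- length.
  filter-cartesianProduct : ∀ {n} xs (vs : List (Vec A n)) →
    filter (All.all? P?) (cartesianProductWith _∷_ xs vs) ≡
    cartesianProductWith _∷_ (filter P? xs) (filter (All.all? P?) vs)
  filter-cartesianProduct []       vs = refl
  filter-cartesianProduct (x ∷ xs) vs
    rewrite filter-++ (All.all? P?) (map (x ∷_) vs) (cartesianProductWith _∷_ xs vs)
          | filter-map-∷ x vs
          | filter-cartesianProduct xs vs
    with P? x
  ... | yes _ = refl
  ... | no  _ = refl

sum-map-0 : ∀ {A : Set} (xs : List A) → sum (map (λ _ → 0) xs) ≡ 0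
sum-map-0 []       = refl
sum-map-0 (x ∷ xs) = sum-map-0 xs

sum-map-+ : ∀ {A : Set} (f g : A → ℕ) xs →
            sum (map (λ x → f x + g x) xs) ≡ sum (map f xs) + sum (map g xs)
sum-map-+ f g []       = refl
sum-map-+ f g (x ∷ xs) rewrite sum-map-+ f g xs = rearrange (f x) (g x) (sum (map f xs)) (sum (map g xs))
  where
  rearrange : ∀ a b c d → a + b + (c + d) ≡ a + c + (b + d)
  rearrange = solve-∀

-- Exchanges the order of summation: the sum over the new column has to be the inner one, with the
-- remaining columns fixed.
sum-map-cartesianProductWith : ∀ {A B C : Set} (f : A → B → C) (g : C → ℕ) xs ys →
  sum (map g (cartesianProductWith f xs ys)) ≡ sum (map (λ y → sum (map (λ x → g (f x y)) xs)) ys)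
sum-map-cartesianProductWith f g []       ys = sym (sum-map-0 ys)
sum-map-cartesianProductWith f g (x ∷ xs) ys = begin
  sum (map g (map (f x) ys ++ rest))                   ≡⟨ cong sum (map-++ g (map (f x) ys) rest) ⟩
  sum (map g (map (f x) ys) ++ map g rest)             ≡⟨ sum-++ (map g (map (f x) ys)) (map g rest) ⟩
  sum (map g (map (f x) ys)) + sum (map g rest)        ≡⟨ cong₂ _+_ (cong sum (sym (map-∘ ys)))
                                                            (sum-map-cartesianProductWith f g xs ys) ⟩
  sum (map (g ∘ f x) ys) + sum (map (λ y → sum (map (λ x → g (f x y)) xs)) ys)
                                                       ≡⟨ sum-map-+ (g ∘ f x) _ ys ⟨
  sum (map (λ y → g (f x y) + sum (map (λ x → g (f x y)) xs)) ys) ∎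
  where
  open ≡-Reasoning

  rest : List _
  rest = cartesianProductWith f xs ys

-- Adding a uniformly random admissible column to N moves rowGap (suc i) N by one
-- step of the reflected walk.
rowGap : ∀ {n} → Fin 4 → Matrix4× n → ℕ
rowGap i N = ∣ rowSum i N - rowSum 0F (switch N) ∣

-- Both moves away from difference 0 lead to distance 1, whence the coefficient 2 in `step`.
-- Lowering x - y is expressed by raising `y`.
step-∣-∣ : ∀ F x y → F ∣ suc x - y ∣ + 6 * F ∣ x - y ∣ + F ∣ x - suc y ∣ ≡ step F ∣ x - y ∣
step-∣-∣ F zero    zero    = rearrange (F 0) (F 1)
  where
  rearrange : ∀ a b → b + 6 * a + b ≡ 6 * a + 2 * b
  rearrange = solve-∀
step-∣-∣ F zero    (suc y) = refl
step-∣-∣ F (suc x) zero    = trans (rearrange (F (suc (suc x))) (6 * F (suc x)) (F ∣ x - 0 ∣))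
  (cong (λ z → F z + 6 * F (suc x) + F (suc (suc x))) (ℕ.∣-∣-identityʳ x))
  where
  rearrange : ∀ a b c → a + b + c ≡ c + b + a
  rearrange = solve-∀
step-∣-∣ F (suc x) (suc y) = step-∣-∣ F x y

gapSum : Fin 4 → (ℕ → ℕ) → ℕ → ℕ → ℕ
gapSum i F x y =
  sum (map (λ v → F ∣ indicator (lookup v i) + x - indicator (lookup (switchColumn v) 0F) + y ∣) admissibleColumns)

-- Columns with 0 or 4 ones leave the gap alone. For one with two ones the signed difference changes
-- by vᵢ + v₀ - 1, where i is the chosen row: this is +1 for one column, -1 for its complement and 0
-- for the other four.
gapSum-step : ∀ i F x y → gapSum (suc i) F x y ≡ step F ∣ x - y ∣
gapSum-step i F x y = trans (collect i) (step-∣-∣ F x y)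
  where
  m z p : ℕ
  m = F ∣ suc x - y ∣
  z = F ∣ x - y ∣
  p = F ∣ x - suc y ∣

  -- The columns are enumerated lexicographically from 0000 to 1111; `m` stands at the two-element
  -- column containing row 0 and the chosen row, `p` at its complement.
  first : ∀ m z p → z + (p + (z + (z + (z + (z + (m + (z + 0))))))) ≡ m + 6 * z + p
  first = solve-∀

  second : ∀ m z p → z + (z + (p + (z + (z + (m + (z + (z + 0))))))) ≡ m + 6 * z + p
  second = solve-∀

  third : ∀ m z p → z + (z + (z + (p + (m + (z + (z + (z + 0))))))) ≡ m + 6 * z + p
  third = solve-∀

  collect : ∀ i → gapSum (suc i) F x y ≡ m + 6 * z + p
  collect 0F = first m z p
  collect 1F = second m z p
  collect 2F = third m z p

-- The gap is distributed as the reflected walk at time n. `F` is arbitrary because the induction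
-- replaces it by `step F`.
sum-gap : ∀ n i F → sum (map (F ∘ rowGap (suc i)) (admissibleMatrices n)) ≡ steps n F 0
sum-gap zero    i F = ℕ.+-identityʳ (F 0)
sum-gap (suc n) i F = begin
  sum (map (F ∘ rowGap (suc i)) (admissibleMatrices (suc n)))
    ≡⟨ cong (sum ∘ map (F ∘ rowGap (suc i))) (filter-cartesianProduct admissibleColumn? (allVecs (false ∷ true ∷ []) 4) (allMatrices n)) ⟩
  sum (map (F ∘ rowGap (suc i)) (cartesianProductWith _∷_ admissibleColumns (admissibleMatrices n)))
    ≡⟨ sum-map-cartesianProductWith _∷_ (F ∘ rowGap (suc i)) admissibleColumns (admissibleMatrices n) ⟩
  sum (map (λ N → sum (map (λ v → F (rowGap (suc i) (v ∷ N))) admissibleColumns)) (admissibleMatrices n))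
    ≡⟨ cong sum (map-cong extend (admissibleMatrices n)) ⟩
  sum (map (step F ∘ rowGap (suc i)) (admissibleMatrices n))
    ≡⟨ sum-gap n i (step F) ⟩
  steps n (step F) 0
    ≡⟨ cong (λ G → G 0) (steps-step n F) ⟩
  steps (suc n) F 0 ∎
  where
  open ≡-Reasoning

  extend : ∀ N → sum (map (λ v → F (rowGap (suc i) (v ∷ N))) admissibleColumns) ≡ step F (rowGap (suc i) N)
  extend N = trans
    (cong sum (map-cong (λ v → cong F (cong₂ ∣_-_∣ (rowSum-∷ (suc i) v N) (rowSum-∷ 0F (switchColumn v) (switch N)))) admissibleColumns))
    (gapSum-step i F (rowSum (suc i) N) (rowSum 0F (switch N)))

-- Degrees and edges of the two graphs

∣b∷p∣ : ∀ {n} b (p : Subset n) → ∣ b ∷ p ∣ ≡ indicator b + ∣ p ∣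
∣b∷p∣ true  p = refl
∣b∷p∣ false p = refl

∣p++q∣ : ∀ {m n} (p : Subset m) (q : Subset n) → ∣ p Vec.++ q ∣ ≡ ∣ p ∣ + ∣ q ∣
∣p++q∣ []          q = refl
∣p++q∣ (true  ∷ p) q = cong suc (∣p++q∣ p q)
∣p++q∣ (false ∷ p) q = ∣p++q∣ p q

∣switchColumn∣ : ∀ v → ∣ switchColumn v ∣ ≡ ∣ v ∣
-- `does (∣ v ∣ ℕ.≟ 2)` computes to this Boolean test.
∣switchColumn∣ v with ∣ v ∣ ℕ.≡ᵇ 2 in eq
... | false = refl
... | true  = trans (∣∁p∣≡n∸∣p∣ v) (trans (cong (4 ∸_) ∣v∣≡2) (sym ∣v∣≡2))
  where
  ∣v∣≡2 : ∣ v ∣ ≡ 2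
  ∣v∣≡2 = ℕ.≡ᵇ⇒≡ ∣ v ∣ 2 (subst T (sym eq) tt)

numOnes : ∀ {n} → Matrix4× n → ℕ
numOnes N = rowSum 0F N + (rowSum 1F N + (rowSum 2F N + rowSum 3F N))

-- Double counting: `numOnes` adds up rows, whereas switching acts on columns.
numOnes-∷ : ∀ {n} v (N : Matrix4× n) → numOnes (v ∷ N) ≡ ∣ v ∣ + numOnes N
numOnes-∷ v@(a ∷ b ∷ c ∷ d ∷ []) N
  rewrite rowSum-∷ 0F v N | rowSum-∷ 1F v N
        | rowSum-∷ 2F v N | rowSum-∷ 3F v N
        | ∣b∷p∣ a (b ∷ c ∷ d ∷ []) | ∣b∷p∣ b (c ∷ d ∷ []) | ∣b∷p∣ c (d ∷ []) | ∣b∷p∣ d [] =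
  rearrange (indicator a) (indicator b) (indicator c) (indicator d) _ _ _ _
  where
  rearrange : ∀ a b c d w x y z → a + w + (b + x + (c + y + (d + z))) ≡
                                  a + (b + (c + (d + 0))) + (w + (x + (y + z)))
  rearrange = solve-∀

numOnes-switch : ∀ {n} (N : Matrix4× n) → numOnes (switch N) ≡ numOnes N
numOnes-switch []      = refl
numOnes-switch (v ∷ N) = begin
  numOnes (switchColumn v ∷ switch N)     ≡⟨ numOnes-∷ (switchColumn v) (switch N) ⟩
  ∣ switchColumn v ∣ + numOnes (switch N) ≡⟨ cong₂ _+_ (∣switchColumn∣ v) (numOnes-switch N) ⟩
  ∣ v ∣ + numOnes N                       ≡⟨ numOnes-∷ v N ⟨
  numOnes (v ∷ N)                         ∎
  where open ≡-Reasoning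

∈-allVecs : ∀ {n} (v : Vec Bool n) → v ∈ allVecs (false ∷ true ∷ []) n
∈-allVecs []          = here refl
∈-allVecs (false ∷ v) = ∈-cartesianProductWith⁺ _∷_ {xs = false ∷ true ∷ []} (here refl) (∈-allVecs v)
∈-allVecs (true  ∷ v) = ∈-cartesianProductWith⁺ _∷_ {xs = false ∷ true ∷ []} (there (here refl)) (∈-allVecs v)

-- In every row the sum is 0, 1 or 2 according as the column has 0, 2 or 4 ones; verified by running
-- through all sixteen columns.
column+switchColumn : ∀ v → AdmissibleColumn v → ∀ i →
  indicator (lookup v i) + indicator (lookup (switchColumn v) i) ≡
  indicator (lookup v 0F) + indicator (lookup (switchColumn v) 0F)
column+switchColumn v = ListAll.lookup
  (from-yes (ListAll.all?
    (λ v → admissibleColumn? v →-dec Fin.all? (λ i →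
      indicator (lookup v i) + indicator (lookup (switchColumn v) i) ℕ.≟
      indicator (lookup v 0F) + indicator (lookup (switchColumn v) 0F)))
    (allVecs (false ∷ true ∷ []) 4)))
  (∈-allVecs v)

rowSum+rowSum-switch : ∀ {n} {N : Matrix4× n} → GMAdmissible N → ∀ i →
  rowSum i N + rowSum i (switch N) ≡ rowSum 0F N + rowSum 0F (switch N)
rowSum+rowSum-switch []                  i = refl
rowSum+rowSum-switch {N = v ∷ N} (a ∷ as) i = begin
  rowSum i (v ∷ N) + rowSum i (switch (v ∷ N))
    ≡⟨ split i ⟩
  (indicator (lookup v i) + indicator (lookup (switchColumn v) i)) + (rowSum i N + rowSum i (switch N))
    ≡⟨ cong₂ _+_ (column+switchColumn v a i) (rowSum+rowSum-switch as i) ⟩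
  (indicator (lookup v 0F) + indicator (lookup (switchColumn v) 0F)) + (rowSum 0F N + rowSum 0F (switch N))
    ≡⟨ split 0F ⟨
  rowSum 0F (v ∷ N) + rowSum 0F (switch (v ∷ N)) ∎
  where
  open ≡-Reasoning

  rearrange : ∀ a b c d → a + b + (c + d) ≡ a + c + (b + d)
  rearrange = solve-∀

  split : ∀ i → rowSum i (v ∷ N) + rowSum i (switch (v ∷ N)) ≡
    (indicator (lookup v i) + indicator (lookup (switchColumn v) i)) + (rowSum i N + rowSum i (switch N))
  split i = trans (cong₂ _+_ (rowSum-∷ i v N) (rowSum-∷ i (switchColumn v) (switch N)))
    (rearrange (indicator (lookup v i)) (rowSum i N) (indicator (lookup (switchColumn v) i)) (rowSum i (switch N)))

module _ {n} (B : Graph 4) (N : Matrix4× n) (C : Graph n) where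

  degree-block-↑ˡ : ∀ i → degree (block B N C) (i ↑ˡ n) ≡ degree B i + rowSum i N
  -- For a concrete index `splitAt 4` reduces, and the neighbourhood is a concatenation by
  -- definition.
  degree-block-↑ˡ 0F = ∣p++q∣ (neighbours B 0F) (row 0F N)
  degree-block-↑ˡ 1F = ∣p++q∣ (neighbours B 1F) (row 1F N)
  degree-block-↑ˡ 2F = ∣p++q∣ (neighbours B 2F) (row 2F N)
  degree-block-↑ˡ 3F = ∣p++q∣ (neighbours B 3F) (row 3F N)

  degree-block-↑ʳ : ∀ j → degree (block B N C) (4 ↑ʳ j) ≡ ∣ lookup N j ∣ + degree C j
  degree-block-↑ʳ j = trans (∣p++q∣ (tabulate (lookup (lookup N j))) (neighbours C j))
    (cong (λ p → ∣ p ∣ + degree C j) (tabulate∘lookup (lookup N j)))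

  -- The vertices of `B` come first, so a mixed edge is counted in its row of `B`, where the order
  -- test is `true`, and not in its row of `C`, where it is `false`.
  numEdges-block : numEdges (block B N C) ≡ numEdges B + numOnes N + numEdges C
  numEdges-block = trans
    (cong₂ _+_ (rowB 0F) (cong₂ _+_ (rowB 1F) (cong₂ _+_ (rowB 2F)
      (cong₂ _+_ (rowB 3F) (cong Vec.sum (tabulate-cong rowC))))))
    (rearrange (∣ later 0F ∣) (∣ later 1F ∣) (∣ later 2F ∣) (∣ later 3F ∣)
      (rowSum 0F N) (rowSum 1F N) (rowSum 2F N) (rowSum 3F N) (numEdges C))
    where
    later : Fin 4 → Subset 4
    later i = tabulate λ j → adj B i j ∧ (toℕ i ℕ.<ᵇ toℕ j)

    rowB : ∀ i → ∣ later i Vec.++ tabulate (λ j → lookup (lookup N j) i ∧ true) ∣ ≡ ∣ later i ∣ + rowSum i N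
    rowB i = trans (∣p++q∣ (later i) (tabulate λ j → lookup (lookup N j) i ∧ true))
      (cong (λ p → ∣ later i ∣ + ∣ p ∣) (tabulate-cong λ j → ∧-identityʳ (lookup (lookup N j) i)))

    rowC : ∀ i → ∣ tabulate (λ j → adj (block B N C) (4 ↑ʳ i) j ∧ (toℕ (4 ↑ʳ i) ℕ.<ᵇ toℕ j)) ∣ ≡
                 ∣ tabulate (λ j → adj C i j ∧ (toℕ i ℕ.<ᵇ toℕ j)) ∣
    rowC i = cong ∣_∣ (cong₂ _∷_ (zero∧ 0F) (cong₂ _∷_ (zero∧ 1F)
      (cong₂ _∷_ (zero∧ 2F) (cong₂ _∷_ (zero∧ 3F) (refl {x = tabulate λ j → adj C i j ∧ (toℕ i ℕ.<ᵇ toℕ j)})))))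
      where
      zero∧ : ∀ k → lookup (lookup N i) k ∧ false ≡ false
      zero∧ k = ∧-zeroʳ (lookup (lookup N i) k)

    rearrange : ∀ a b c d w x y z e → a + w + (b + x + (c + y + (d + z + e))) ≡
                                      a + (b + (c + (d + 0))) + (w + (x + (y + z))) + e
    rearrange = solve-∀

numEdges-block-switch : ∀ {n} (B : Graph 4) (N : Matrix4× n) (C : Graph n) →
                        numEdges (block B N C) ≡ numEdges (block B (switch N) C)
numEdges-block-switch B N C = trans (numEdges-block B N C) (trans
  (cong (λ k → numEdges B + k + numEdges C) (sym (numOnes-switch N)))
  (sym (numEdges-block B (switch N) C)))

-- The apex is vertex 0 and counts all its edges; the remaining rows reduce to those of the base.
numEdges-cone : ∀ {n} (G H : Graph n) → numEdges G ≡ numEdges H → numEdges (cone G) ≡ numEdges (cone H)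
numEdges-cone {n} G H =
  cong λ m → ∣ tabulate {n = suc n} (λ j → adj (cone G) zero j ∧ (0 ℕ.<ᵇ toℕ j)) ∣ + m

-- Comparing the products over the vertices of B

-- The linear relations have been used to eliminate x₃, y₁, y₂, y₃. If x₁ = y₀, then y₁ = x₀, y₂ =
-- x₃ and y₃ = x₂, so the products agree; similarly for x₂ and x₃. If the first factor on the right
-- vanishes, each s + yᵢ is -(s + xᵢ), and the four signs cancel.
factorIdentity : ∀ s x₀ x₁ x₂ y₀ →
  let x₃ = x₀ ℤ.+ (y₀ ℤ.+ y₀) ℤ.- x₁ ℤ.- x₂
      y₁ = x₀ ℤ.+ y₀ ℤ.- x₁
      y₂ = x₀ ℤ.+ y₀ ℤ.- x₂
      y₃ = x₀ ℤ.+ y₀ ℤ.- x₃ in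
  (s ℤ.+ x₀) ℤ.* ((s ℤ.+ x₁) ℤ.* ((s ℤ.+ x₂) ℤ.* (s ℤ.+ x₃))) ℤ.-
  (s ℤ.+ y₀) ℤ.* ((s ℤ.+ y₁) ℤ.* ((s ℤ.+ y₂) ℤ.* (s ℤ.+ y₃))) ≡
  (s ℤ.+ x₀ ℤ.+ (s ℤ.+ y₀)) ℤ.* ((x₁ ℤ.- y₀) ℤ.* ((x₂ ℤ.- y₀) ℤ.* (x₃ ℤ.- y₀)))
factorIdentity = ℤ.solve-∀

Coincidence : (x : Fin 4 → ℕ) → ℕ → Set
Coincidence x y = x 1F ≡ y ⊎ x 2F ≡ y ⊎ x 3F ≡ y

-- For the case of a vanishing first factor in `factorIdentity`: all five numbers are below 3, and a
-- finite search settles it.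
smallCoincidence : ∀ x₀ y₀ x₁ x₂ x₃ → x₀ + y₀ ≤ 2 → x₁ ≤ x₀ + y₀ → x₂ ≤ x₀ + y₀ → x₃ ≤ x₀ + y₀ →
                   x₁ + (x₂ + x₃) ≡ x₀ + (y₀ + y₀) → x₁ ≡ y₀ ⊎ x₂ ≡ y₀ ⊎ x₃ ≡ y₀
smallCoincidence x₀ y₀ x₁ x₂ x₃ t≤2 p q r e =
  back (search (fin x₀<3) (fin y₀<3) (fin x₁<3) (fin x₂<3) (fin x₃<3))
  where
  fin : ∀ {k} → k < 3 → Fin 3
  fin k<3 = fromℕ< k<3

  x₀<3 : x₀ < 3
  x₀<3 = s≤s (ℕ.≤-trans (ℕ.m≤m+n x₀ y₀) t≤2)

  y₀<3 : y₀ < 3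
  y₀<3 = s≤s (ℕ.≤-trans (ℕ.m≤n+m y₀ x₀) t≤2)

  x₁<3 : x₁ < 3
  x₁<3 = s≤s (ℕ.≤-trans p t≤2)

  x₂<3 : x₂ < 3
  x₂<3 = s≤s (ℕ.≤-trans q t≤2)

  x₃<3 : x₃ < 3
  x₃<3 = s≤s (ℕ.≤-trans r t≤2)

  Claim : (a b c d e : ℕ) → Set
  Claim a b c d e = a + b ≤ 2 → c ≤ a + b → d ≤ a + b → e ≤ a + b → c + (d + e) ≡ a + (b + b) → c ≡ b ⊎ d ≡ b ⊎ e ≡ b

  search : ∀ (a b c d e : Fin 3) → Claim (toℕ a) (toℕ b) (toℕ c) (toℕ d) (toℕ e)
  search = from-yes (Fin.all? {n = 3} λ a → Fin.all? {n = 3} λ b → Fin.all? {n = 3} λ c → Fin.all? {n = 3} λ d → Fin.all? {n = 3} λ e →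
    (toℕ a + toℕ b ℕ.≤? 2) →-dec ((toℕ c ℕ.≤? toℕ a + toℕ b) →-dec ((toℕ d ℕ.≤? toℕ a + toℕ b) →-dec ((toℕ e ℕ.≤? toℕ a + toℕ b) →-dec
    ((toℕ c + (toℕ d + toℕ e) ℕ.≟ toℕ a + (toℕ b + toℕ b)) →-dec
    ((toℕ c ℕ.≟ toℕ b) ⊎-dec ((toℕ d ℕ.≟ toℕ b) ⊎-dec (toℕ e ℕ.≟ toℕ b))))))))

  back : Claim (toℕ (fin x₀<3)) (toℕ (fin y₀<3)) (toℕ (fin x₁<3)) (toℕ (fin x₂<3)) (toℕ (fin x₃<3)) →
         x₁ ≡ y₀ ⊎ x₂ ≡ y₀ ⊎ x₃ ≡ y₀
  back c rewrite Fin.toℕ-fromℕ< x₀<3 | Fin.toℕ-fromℕ< y₀<3 | Fin.toℕ-fromℕ< x₁<3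
               | Fin.toℕ-fromℕ< x₂<3 | Fin.toℕ-fromℕ< x₃<3 = c t≤2 p q r e

-- The contribution of a vertex of `B`: `s` gathers its neighbours outside the block `N`, and `a` is
-- its row sum.
factor : ℕ → ℕ → ℤ
factor s a = + (s + a) ℤ.- 1ℤ

factor-split : ∀ s a → factor s a ≡ (+ s ℤ.- 1ℤ) ℤ.+ + a
factor-split s a = trans (cong (ℤ._- 1ℤ) (ℤ.pos-+ s a)) (swap (+ s) (+ a))
  where
  swap : ∀ s a → s ℤ.+ a ℤ.- 1ℤ ≡ (s ℤ.- 1ℤ) ℤ.+ a
  swap = ℤ.solve-∀

module _ (s : ℕ) (x y : Fin 4 → ℕ) (complementary : ∀ i → x i + y i ≡ x 0F + y 0F) where

  -- Adding the four complementarity relations gives 2 Σ xᵢ = 4 (x₀ + y₀); then cancel 2 x₀ and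
  -- halve.
  sum-x : x 0F + (x 1F + (x 2F + x 3F)) ≡ y 0F + (y 1F + (y 2F + y 3F)) →
          x 1F + (x 2F + x 3F) ≡ x 0F + (y 0F + y 0F)
  sum-x Σx≡Σy = ℕ.*-cancelˡ-≡ _ _ 2 (ℕ.+-cancelˡ-≡ (2 * x 0F) _ _ (begin
    2 * x 0F + 2 * (x 1F + (x 2F + x 3F))
      ≡⟨ double (x 0F) (x 1F) (x 2F) (x 3F) ⟩
    (x 0F + (x 1F + (x 2F + x 3F))) + (x 0F + (x 1F + (x 2F + x 3F)))
      ≡⟨ cong (λ z → (x 0F + (x 1F + (x 2F + x 3F))) + z) Σx≡Σy ⟩
    (x 0F + (x 1F + (x 2F + x 3F))) + (y 0F + (y 1F + (y 2F + y 3F)))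
      ≡⟨ zip (x 0F) (x 1F) (x 2F) (x 3F) (y 0F) (y 1F) (y 2F) (y 3F) ⟩
    (x 0F + y 0F) + ((x 1F + y 1F) + ((x 2F + y 2F) + (x 3F + y 3F)))
      ≡⟨ cong (λ z → (x 0F + y 0F) + z) (cong₂ _+_ (complementary 1F) (cong₂ _+_ (complementary 2F) (complementary 3F))) ⟩
    (x 0F + y 0F) + ((x 0F + y 0F) + ((x 0F + y 0F) + (x 0F + y 0F)))
      ≡⟨ collect (x 0F) (y 0F) ⟩
    2 * x 0F + 2 * (x 0F + (y 0F + y 0F)) ∎))
    where
    open ≡-Reasoning

    double : ∀ a b c d → 2 * a + 2 * (b + (c + d)) ≡ (a + (b + (c + d))) + (a + (b + (c + d)))
    double = solve-∀

    zip : ∀ a b c d w x y z → (a + (b + (c + d))) + (w + (x + (y + z))) ≡ (a + w) + ((b + x) + ((c + y) + (d + z)))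
    zip = solve-∀

    collect : ∀ a b → (a + b) + ((a + b) + ((a + b) + (a + b))) ≡ 2 * a + 2 * (a + (b + b))
    collect = solve-∀

  coincidence : x 0F + (x 1F + (x 2F + x 3F)) ≡ y 0F + (y 1F + (y 2F + y 3F)) →
    factor s (x 0F) ℤ.* (factor s (x 1F) ℤ.* (factor s (x 2F) ℤ.* factor s (x 3F))) ≡
    factor s (y 0F) ℤ.* (factor s (y 1F) ℤ.* (factor s (y 2F) ℤ.* factor s (y 3F))) →
    Coincidence x (y 0F)
  coincidence Σx≡Σy Πx≡Πy = [ τ≡0-case , differences ]′ (ℤ.i*j≡0⇒i≡0∨j≡0 τ τ*differences≡0)
    where
    σ x₀ x₁ x₂ x₃ y₀ τ : ℤ
    σ  = + s ℤ.- 1ℤ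
    x₀ = + x 0F
    x₁ = + x 1F
    x₂ = + x 2F
    x₃ = + x 3F
    y₀ = + y 0F
    τ  = σ ℤ.+ x₀ ℤ.+ (σ ℤ.+ y₀)

    isolate : ∀ a b {c} → a ℤ.+ b ≡ c → b ≡ c ℤ.- a
    isolate a b e = trans (cancel a b) (cong (ℤ._- a) e)
      where
      cancel : ∀ a b → b ≡ a ℤ.+ b ℤ.- a
      cancel = ℤ.solve-∀

    x₃≡ : x₃ ≡ x₀ ℤ.+ (y₀ ℤ.+ y₀) ℤ.- x₁ ℤ.- x₂
    x₃≡ = isolate x₂ x₃ (isolate x₁ (x₂ ℤ.+ x₃) (cong +_ (sum-x Σx≡Σy)))

    y≡ : ∀ i → + y i ≡ x₀ ℤ.+ y₀ ℤ.- + x i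
    y≡ i = isolate (+ x i) (+ y i) (cong +_ (complementary i))

    product₄ : ℤ → ℤ → ℤ → ℤ → ℤ
    product₄ a b c d = (σ ℤ.+ a) ℤ.* ((σ ℤ.+ b) ℤ.* ((σ ℤ.+ c) ℤ.* (σ ℤ.+ d)))

    product-factor : ∀ (z : Fin 4 → ℕ) →
      factor s (z 0F) ℤ.* (factor s (z 1F) ℤ.* (factor s (z 2F) ℤ.* factor s (z 3F))) ≡
      product₄ (+ z 0F) (+ z 1F) (+ z 2F) (+ z 3F)
    product-factor z = cong₂ ℤ._*_ (factor-split s (z 0F)) (cong₂ ℤ._*_ (factor-split s (z 1F))
      (cong₂ ℤ._*_ (factor-split s (z 2F)) (factor-split s (z 3F))))

    products-≡ : product₄ x₀ x₁ x₂ (x₀ ℤ.+ (y₀ ℤ.+ y₀) ℤ.- x₁ ℤ.- x₂) ≡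
      product₄ y₀ (x₀ ℤ.+ y₀ ℤ.- x₁) (x₀ ℤ.+ y₀ ℤ.- x₂) (x₀ ℤ.+ y₀ ℤ.- (x₀ ℤ.+ (y₀ ℤ.+ y₀) ℤ.- x₁ ℤ.- x₂))
    products-≡ = begin
      product₄ x₀ x₁ x₂ (x₀ ℤ.+ (y₀ ℤ.+ y₀) ℤ.- x₁ ℤ.- x₂)
        ≡⟨ cong (product₄ x₀ x₁ x₂) x₃≡ ⟨
      product₄ x₀ x₁ x₂ x₃
        ≡⟨ product-factor x ⟨
      factor s (x 0F) ℤ.* (factor s (x 1F) ℤ.* (factor s (x 2F) ℤ.* factor s (x 3F)))
        ≡⟨ Πx≡Πy ⟩
      factor s (y 0F) ℤ.* (factor s (y 1F) ℤ.* (factor s (y 2F) ℤ.* factor s (y 3F)))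
        ≡⟨ product-factor y ⟩
      product₄ y₀ (+ y 1F) (+ y 2F) (+ y 3F)
        ≡⟨ cong₂ (λ a b → product₄ y₀ a b (+ y 3F)) (y≡ 1F) (y≡ 2F) ⟩
      product₄ y₀ (x₀ ℤ.+ y₀ ℤ.- x₁) (x₀ ℤ.+ y₀ ℤ.- x₂) (+ y 3F)
        ≡⟨ cong (product₄ y₀ (x₀ ℤ.+ y₀ ℤ.- x₁) (x₀ ℤ.+ y₀ ℤ.- x₂)) (trans (y≡ 3F) (cong (λ z → x₀ ℤ.+ y₀ ℤ.- z) x₃≡)) ⟩
      product₄ y₀ (x₀ ℤ.+ y₀ ℤ.- x₁) (x₀ ℤ.+ y₀ ℤ.- x₂) (x₀ ℤ.+ y₀ ℤ.- (x₀ ℤ.+ (y₀ ℤ.+ y₀) ℤ.- x₁ ℤ.- x₂)) ∎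
      where open ≡-Reasoning

    τ*differences≡0 : τ ℤ.* ((x₁ ℤ.- y₀) ℤ.* ((x₂ ℤ.- y₀) ℤ.* (x₃ ℤ.- y₀))) ≡ 0ℤ
    τ*differences≡0 = trans (cong (λ z → τ ℤ.* ((x₁ ℤ.- y₀) ℤ.* ((x₂ ℤ.- y₀) ℤ.* (z ℤ.- y₀)))) x₃≡)
      (trans (sym (factorIdentity σ x₀ x₁ x₂ y₀)) (ℤ.i≡j⇒i-j≡0 products-≡))

    equal : ∀ i → + x i ℤ.- y₀ ≡ 0ℤ → x i ≡ y 0F
    equal i e = ℤ.+-injective (ℤ.i-j≡0⇒i≡j (+ x i) y₀ e)

    differences : (x₁ ℤ.- y₀) ℤ.* ((x₂ ℤ.- y₀) ℤ.* (x₃ ℤ.- y₀)) ≡ 0ℤ → Coincidence x (y 0F)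
    differences e = Sum.map (equal 1F) (λ e′ → Sum.map (equal 2F) (equal 3F)
      (ℤ.i*j≡0⇒i≡0∨j≡0 (x₂ ℤ.- y₀) e′)) (ℤ.i*j≡0⇒i≡0∨j≡0 (x₁ ℤ.- y₀) e)

    -- τ = 0 forces s + x₀ + (s + y₀) = 2.
    τ≡0-case : τ ≡ 0ℤ → Coincidence x (y 0F)
    τ≡0-case τ≡0 = smallCoincidence (x 0F) (y 0F) (x 1F) (x 2F) (x 3F) t≤2
      (bound 1F) (bound 2F) (bound 3F) (sum-x Σx≡Σy)
      where
      bound : ∀ i → x i ≤ x 0F + y 0F
      bound i = ℕ.≤-trans (ℕ.m≤m+n (x i) (y i)) (ℕ.≤-reflexive (complementary i))

      shift : ∀ s a b → s ℤ.+ s ℤ.+ (a ℤ.+ b) ≡ (s ℤ.- 1ℤ ℤ.+ a ℤ.+ (s ℤ.- 1ℤ ℤ.+ b)) ℤ.+ + 2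
      shift = ℤ.solve-∀

      t≤2 : x 0F + y 0F ≤ 2
      t≤2 = ℕ.≤-trans (ℕ.m≤n+m (x 0F + y 0F) (s + s))
        (ℕ.≤-reflexive (ℤ.+-injective (trans (shift (+ s) x₀ y₀) (cong (ℤ._+ + 2) τ≡0))))

-- The proportion of exceptional matrices

product-cong : ∀ {n} {f g : Fin n → ℤ} → f ≗ g → product f ≡ product g
product-cong {zero}  f≗g = refl
product-cong {suc n} f≗g = cong₂ ℤ._*_ (f≗g zero) (product-cong (f≗g ∘ suc))

product≢0 : ∀ {n} {f : Fin n → ℤ} → (∀ i → f i ≢ 0ℤ) → product f ≢ 0ℤ
product≢0 {zero}  f≢0 ()
product≢0 {suc n} {f} f≢0 e = [ f≢0 zero , product≢0 (f≢0 ∘ suc) ]′ (ℤ.i*j≡0⇒i≡0∨j≡0 (f zero) e)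

2≤n⇒n-1≢0 : ∀ {n} → 2 ≤ n → + n ℤ.- 1ℤ ≢ 0ℤ
2≤n⇒n-1≢0 (s≤s (s≤s _)) ()

-- With k = 1 these are the factors of the cone at the vertices of the base.
shiftedExcess : ∀ {n} → ℕ → Graph n → Fin n → ℤ
shiftedExcess k G i = + (k + degree G i) ℤ.- 1ℤ

module _ {n} (B : Graph 4) {r} (regular : ∀ i → degree B i ≡ r) (C : Graph n)
         (k : ℕ) (2≤k+degree : ∀ j → 2 ≤ k + degree C j) where

  rowFactors : Matrix4× n → ℤ
  rowFactors N = factor (k + r) (rowSum 0F N) ℤ.* (factor (k + r) (rowSum 1F N) ℤ.*
    (factor (k + r) (rowSum 2F N) ℤ.* factor (k + r) (rowSum 3F N)))

  columnFactors : Matrix4× n → ℤ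
  columnFactors N = product λ j → + (k + (∣ lookup N j ∣ + degree C j)) ℤ.- 1ℤ

  product-shiftedExcess : ∀ N → product (shiftedExcess k (block B N C)) ≡ rowFactors N ℤ.* columnFactors N
  product-shiftedExcess N = trans
    (cong₂ ℤ._*_ (rowFactor 0F) (cong₂ ℤ._*_ (rowFactor 1F) (cong₂ ℤ._*_ (rowFactor 2F) (cong₂ ℤ._*_ (rowFactor 3F)
      (product-cong λ j → cong (λ d → + (k + d) ℤ.- 1ℤ) (degree-block-↑ʳ B N C j))))))
    (reassociate (factor (k + r) (rowSum 0F N)) (factor (k + r) (rowSum 1F N))
      (factor (k + r) (rowSum 2F N)) (factor (k + r) (rowSum 3F N)) (columnFactors N))
    where
    rowFactor : ∀ i → shiftedExcess k (block B N C) (i ↑ˡ n) ≡ factor (k + r) (rowSum i N)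
    rowFactor i = cong (λ d → + d ℤ.- 1ℤ) (begin
      k + degree (block B N C) (i ↑ˡ n)  ≡⟨ cong (k ℕ.+_) (degree-block-↑ˡ B N C i) ⟩
      k + (degree B i + rowSum i N)      ≡⟨ cong (λ d → k + (d + rowSum i N)) (regular i) ⟩
      k + (r + rowSum i N)               ≡⟨ ℕ.+-assoc k r (rowSum i N) ⟨
      k + r + rowSum i N                 ∎)
      where open ≡-Reasoning

    reassociate : ∀ a b c d p → a ℤ.* (b ℤ.* (c ℤ.* (d ℤ.* p))) ≡ a ℤ.* (b ℤ.* (c ℤ.* d)) ℤ.* p
    reassociate = ℤ.solve-∀

  columnFactors-switch : ∀ N → columnFactors (switch N) ≡ columnFactors N
  columnFactors-switch N = product-cong λ j → cong (λ d → + (k + (d + degree C j)) ℤ.- 1ℤ)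
    (trans (cong ∣_∣ (lookup-map j switchColumn N)) (∣switchColumn∣ (lookup N j)))

  -- Here the minimum degree enters: each vertex of `C`, with the apex counted when `k` is 1, has
  -- degree at least 2.
  columnFactors≢0 : ∀ N → columnFactors N ≢ 0ℤ
  columnFactors≢0 N = product≢0 λ j → 2≤n⇒n-1≢0
    (ℕ.≤-trans (2≤k+degree j) (ℕ.+-monoʳ-≤ k (ℕ.m≤n+m (degree C j) ∣ lookup N j ∣)))

  -- Cancelling the nonzero column factors leaves the vertices of `B`, to which regularity gives the
  -- common shift `k + r`.
  block-coincidence : ∀ N → GMAdmissible N →
    product (shiftedExcess k (block B N C)) ≡ product (shiftedExcess k (block B (switch N) C)) →
    Coincidence (λ i → rowSum i N) (rowSum 0F (switch N))
  block-coincidence N admissible e =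
    coincidence (k + r) (λ i → rowSum i N) (λ i → rowSum i (switch N)) (rowSum+rowSum-switch admissible)
      (sym (numOnes-switch N))
      (ℤ.*-cancelʳ-≡ (rowFactors N) (rowFactors (switch N)) (columnFactors N) {{ℤ.≢-nonZero (columnFactors≢0 N)}} (begin
        rowFactors N ℤ.* columnFactors N                         ≡⟨ product-shiftedExcess N ⟨
        product (shiftedExcess k (block B N C))                  ≡⟨ e ⟩
        product (shiftedExcess k (block B (switch N) C))         ≡⟨ product-shiftedExcess (switch N) ⟩
        rowFactors (switch N) ℤ.* columnFactors (switch N)       ≡⟨ cong (rowFactors (switch N) ℤ.*_) (columnFactors-switch N) ⟩
        rowFactors (switch N) ℤ.* columnFactors N                ∎))
    where open ≡-Reasoning

∣tabulate-true∣ : ∀ n → ∣ tabulate {n = n} (λ _ → true) ∣ ≡ n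
∣tabulate-true∣ zero    = refl
∣tabulate-true∣ (suc n) = cong suc (∣tabulate-true∣ n)

-- Each base vertex gains one neighbour by definition; only the degree n of the apex needs
-- rewriting.
product-excess-cone : ∀ {n} (G : Graph n) →
  product (excess (cone G)) ≡ (+ n ℤ.- 1ℤ) ℤ.* product (shiftedExcess 1 G)
product-excess-cone {n} G =
  cong (λ d → (+ d ℤ.- 1ℤ) ℤ.* product (shiftedExcess 1 G)) (∣tabulate-true∣ n)

Z-cone≈⇒product-shiftedExcess-≡ : ∀ {n} (G H : Graph n) → 2 ≤ n → numEdges G ≡ numEdges H →
  Z (cone G) ≈ Z (cone H) → product (shiftedExcess 1 G) ≡ product (shiftedExcess 1 H)
Z-cone≈⇒product-shiftedExcess-≡ {n} G H 2≤n m≡m′ Z≈ =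
  ℤ.*-cancelˡ-≡ (+ n ℤ.- 1ℤ) (product (shiftedExcess 1 G)) (product (shiftedExcess 1 H))
    {{ℤ.≢-nonZero (2≤n⇒n-1≢0 2≤n)}} (begin
      (+ n ℤ.- 1ℤ) ℤ.* product (shiftedExcess 1 G)  ≡⟨ product-excess-cone G ⟨
      product (excess (cone G))                     ≡⟨ Z≈⇒product-excess-≡ (cone G) (cone H) (numEdges-cone G H m≡m′) Z≈ ⟩
      product (excess (cone H))                     ≡⟨ product-excess-cone H ⟩
      (+ n ℤ.- 1ℤ) ℤ.* product (shiftedExcess 1 H)  ∎)
  where open ≡-Reasoning

module _ {n} (B : Graph 4) {r} (regular : ∀ i → degree B i ≡ r) (C : Graph n) where

  Z≈⇒coincidence : MinDegree≥ 2 C → ∀ N → GMAdmissible N →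
    Z (block B N C) ≈ Z (block B (switch N) C) →
    Coincidence (λ i → rowSum i N) (rowSum 0F (switch N))
  Z≈⇒coincidence minDegree N admissible Z≈ = block-coincidence B regular C 0 minDegree N admissible
    (Z≈⇒product-excess-≡ (block B N C) (block B (switch N) C) (numEdges-block-switch B N C) Z≈)

  Z-cone≈⇒coincidence : MinDegree≥ 1 C → ∀ N → GMAdmissible N →
    Z (cone (block B N C)) ≈ Z (cone (block B (switch N) C)) →
    Coincidence (λ i → rowSum i N) (rowSum 0F (switch N))
  Z-cone≈⇒coincidence minDegree N admissible Z≈ =
    block-coincidence B regular C 1 (λ j → s≤s (minDegree j)) N admissible
      (Z-cone≈⇒product-shiftedExcess-≡ (block B N C) (block B (switch N) C) (s≤s (s≤s z≤n))
        (numEdges-block-switch B N C) Z≈)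

-- From counting exceptions to the limit

module _ {A : Set} {P : Pred A 0ℓ} (P? : Decidable P) where

  -- A union bound: every element failing `P` is paid for by its value of `f`.
  length≤length-filter+sum : ∀ (f : A → ℕ) {xs} → ListAll.All (λ x → ¬ P x → 1 ≤ f x) xs →
                             length xs ≤ length (filter P? xs) + sum (map f xs)
  length≤length-filter+sum f ListAll.[]                  = z≤n
  length≤length-filter+sum f {x ∷ xs} (px ListAll.∷ pxs) with P? x | length≤length-filter+sum f pxs
  ... | yes _  | ih = s≤s (ℕ.≤-trans ih (ℕ.+-monoʳ-≤ (length (filter P? xs)) (ℕ.m≤n+m (sum (map f xs)) (f x))))
  ... | no ¬p  | ih = ℕ.≤-trans (ℕ.+-mono-≤ (px ¬p) ih)
                        (ℕ.≤-reflexive (swap (f x) (length (filter P? xs)) (sum (map f xs))))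
    where
    swap : ∀ a b c → a + (b + c) ≡ b + (a + c)
    swap = solve-∀

coincidences : ∀ {n} → Matrix4× n → ℕ
coincidences N = δ₀ (rowGap 1F N) + (δ₀ (rowGap 2F N) + δ₀ (rowGap 3F N))

coincidence⇒1≤coincidences : ∀ {n} (N : Matrix4× n) →
  Coincidence (λ i → rowSum i N) (rowSum 0F (switch N)) → 1 ≤ coincidences N
coincidence⇒1≤coincidences N = [ (λ e → ℕ.≤-trans (visit 1F e) (ℕ.m≤m+n _ _)) ,
  [ (λ e → ℕ.≤-trans (visit 2F e) (ℕ.≤-trans (ℕ.m≤m+n _ _) (ℕ.m≤n+m _ (δ₀ (rowGap 1F N))))) ,
    (λ e → ℕ.≤-trans (visit 3F e) (ℕ.≤-trans (ℕ.m≤n+m _ (δ₀ (rowGap 2F N))) (ℕ.m≤n+m _ (δ₀ (rowGap 1F N))))) ]′ ]′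
  where
  visit : ∀ i → rowSum i N ≡ rowSum 0F (switch N) → 1 ≤ δ₀ (rowGap i N)
  visit i e = ℕ.≤-reflexive (sym (cong δ₀ (ℕ.m≡n⇒∣m-n∣≡0 e)))

-- Each of the three gaps follows the same walk, and by additivity their dependence does not matter.
sum-coincidences : ∀ n → sum (map coincidences (admissibleMatrices n)) ≡ 3 * steps n δ₀ 0
sum-coincidences n = begin
  sum (map coincidences Ns)
    ≡⟨ sum-map-+ (δ₀ ∘ rowGap 1F) (λ N → δ₀ (rowGap 2F N) + δ₀ (rowGap 3F N)) Ns ⟩
  sum (map (δ₀ ∘ rowGap 1F) Ns) + sum (map (λ N → δ₀ (rowGap 2F N) + δ₀ (rowGap 3F N)) Ns)
    ≡⟨ cong (λ z → sum (map (δ₀ ∘ rowGap 1F) Ns) + z) (sum-map-+ (δ₀ ∘ rowGap 2F) (δ₀ ∘ rowGap 3F) Ns) ⟩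
  sum (map (δ₀ ∘ rowGap 1F) Ns) + (sum (map (δ₀ ∘ rowGap 2F) Ns) + sum (map (δ₀ ∘ rowGap 3F) Ns))
    ≡⟨ cong₂ _+_ (sum-gap n 0F δ₀) (cong₂ _+_ (sum-gap n 1F δ₀) (sum-gap n 2F δ₀)) ⟩
  steps n δ₀ 0 + (steps n δ₀ 0 + steps n δ₀ 0)
    ≡⟨ cong (λ z → steps n δ₀ 0 + (steps n δ₀ 0 + z)) (ℕ.+-identityʳ (steps n δ₀ 0)) ⟨
  3 * steps n δ₀ 0 ∎
  where
  open ≡-Reasoning

  Ns : List (Matrix4× n)
  Ns = admissibleMatrices n

-- A positive `ε` is at least `1 / ↧ₙ ε`, so it suffices that the proportion of exceptions is below
-- that.
fraction-close-to-1 : ∀ g l .{{_ : NonZero l}} ε → 0ℚ ℚ.< ε → g ≤ l →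
  ℚ.↧ₙ ε * (l ∸ g) < l → ℚ.∣ (+ g ℚ./ l) ℚ.- 1ℚ ∣ ℚ.< ε
fraction-close-to-1 g (suc l) ε@(ℚ.mkℚ -[1+ p ] q _) (ℚ.*<* ()) g≤l b<l
fraction-close-to-1 g (suc l) ε@(ℚ.mkℚ (+ zero) q _) (ℚ.*<* (ℤ.+<+ ())) g≤l b<l
fraction-close-to-1 g (suc l) ε@(ℚ.mkℚ (+ suc p) q _) 0<ε g≤l b<l =
  -- Unnormalised rationals keep `g` and `suc l` as numerator and denominator, which reduces the
  -- claim to integers.
  ℚ.toℚᵘ-cancel-< (ℚᵘ.<-respˡ-≃ (ℚᵘ.≃-sym value) (ℚᵘ.*<* (subst₂ ℤ._<_ numeratorˡ numeratorʳ (ℤ.+<+ small))))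
  where
  a : ℚ.ℚ
  a = + g ℚ./ suc l

  aᵘ : ℚᵘ.ℚᵘ
  aᵘ = ℚᵘ.mkℚᵘ (+ g) l

  value : ℚ.toℚᵘ ℚ.∣ a ℚ.- 1ℚ ∣ ℚᵘ.≃ ℚᵘ.∣ aᵘ ℚᵘ.- ℚᵘ.1ℚᵘ ∣
  value = ℚᵘ.≃-trans (ℚ.toℚᵘ-homo-∣-∣ (a ℚ.- 1ℚ)) (ℚᵘ.∣-∣-cong
    (ℚᵘ.≃-trans (ℚ.toℚᵘ-homo-+ a (ℚ.- 1ℚ)) (ℚᵘ.+-congˡ (ℚᵘ.- ℚᵘ.1ℚᵘ) (ℚ.toℚᵘ-fromℚᵘ aᵘ))))

  small : (suc l ∸ g) * suc q < suc p * (suc l * 1)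
  small = begin-strict
    (suc l ∸ g) * suc q   ≡⟨ ℕ.*-comm (suc l ∸ g) (suc q) ⟩
    suc q * (suc l ∸ g)   <⟨ b<l ⟩
    suc l                 ≡⟨ ℕ.*-identityʳ (suc l) ⟨
    suc l * 1             ≤⟨ ℕ.m≤m+n (suc l * 1) (p * (suc l * 1)) ⟩
    suc p * (suc l * 1)   ∎
    where open ℕ.≤-Reasoning

  numeratorˡ : + ((suc l ∸ g) * suc q) ≡ ℚᵘ.↥ ℚᵘ.∣ aᵘ ℚᵘ.- ℚᵘ.1ℚᵘ ∣ ℤ.* + suc q
  numeratorˡ = trans (ℤ.pos-* (suc l ∸ g) (suc q)) (cong (λ z → + z ℤ.* + suc q) (sym (begin
    ℤ.∣ + g ℤ.* + 1 ℤ.+ -1ℤ ℤ.* + suc l ∣   ≡⟨ cong ℤ.∣_∣ (difference (+ g) (+ suc l)) ⟩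
    ℤ.∣ + g ℤ.- + suc l ∣                   ≡⟨ cong ℤ.∣_∣ (ℤ.m-n≡m⊖n g (suc l)) ⟩
    ℤ.∣ g ℤ.⊖ suc l ∣                       ≡⟨ ℤ.∣⊖∣-≤ g≤l ⟩
    suc l ∸ g                               ∎)))
    where
    open ≡-Reasoning

    difference : ∀ x y → x ℤ.* + 1 ℤ.+ -1ℤ ℤ.* y ≡ x ℤ.- y
    difference = ℤ.solve-∀

  numeratorʳ : + (suc p * (suc l * 1)) ≡ + suc p ℤ.* ℚᵘ.↧ ℚᵘ.∣ aᵘ ℚᵘ.- ℚᵘ.1ℚᵘ ∣
  numeratorʳ = ℤ.pos-* (suc p) (suc l * 1)

module _ {P : ∀ n → Pred (Matrix4× n) 0ℓ} (P? : ∀ n → Decidable (P n)) (n₁ : ℕ)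
         (exceptional : ∀ n → n₁ ≤ n → ∀ N → GMAdmissible N → ¬ P n N →
                        Coincidence (λ i → rowSum i N) (rowSum 0F (switch N))) where

  exceptions-bound : ∀ n → n₁ ≤ n →
    length (admissibleMatrices n) ≤ length (filter (P? n) (admissibleMatrices n)) + 3 * steps n δ₀ 0
  exceptions-bound n n₁≤n = ℕ.≤-trans
    (length≤length-filter+sum (P? n) coincidences
      (ListAll.map (λ {N} admissible ¬p → coincidence⇒1≤coincidences N (exceptional n n₁≤n N admissible ¬p))
        (all-filter gmAdmissible? (allMatrices n))))
    (ℕ.≤-reflexive (cong (length (filter (P? n) (admissibleMatrices n)) ℕ.+_) (sum-coincidences n)))

  proportion-tendsTo-1 : (λ n → proportionOfAdmissible n (P? n)) TendsTo 1ℚ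
  -- The `suc` makes n positive, as `visits-bound` requires.
  proportion-tendsTo-1 ε 0<ε = n₁ + suc (4 * (k * k)) , λ n n₀≤n → close n
    (ℕ.≤-trans (ℕ.m≤m+n n₁ _) n₀≤n) (ℕ.≤-trans (ℕ.m≤n+m (suc (4 * (k * k))) n₁) n₀≤n)
    where
    q k : ℕ
    q = ℚ.↧ₙ ε
    -- Three rows, each exceptional with probability at most 1/k, give 3/(4q) < 1/q.
    k = 4 * q

    close : ∀ n → n₁ ≤ n → 4 * (k * k) < n → ℚ.∣ proportionOfAdmissible n (P? n) ℚ.- 1ℚ ∣ ℚ.< ε
    close n n₁≤n 4k²<n = fraction-close-to-1 g l {{l≢0}} ε 0<ε (length-filter (P? n) (admissibleMatrices n))
      (ℕ.*-cancelˡ-< 4 (q * (l ∸ g)) l (begin-strict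
        4 * (q * (l ∸ g))    ≡⟨ ℕ.*-assoc 4 q (l ∸ g) ⟨
        k * (l ∸ g)          ≤⟨ ℕ.*-monoʳ-≤ k (ℕ.m≤n+o⇒m∸n≤o l g (exceptions-bound n n₁≤n)) ⟩
        k * (3 * d)          ≡⟨ swap k d ⟩
        3 * (k * d)          ≤⟨ ℕ.*-monoʳ-≤ 3 (visits-bound k n {{ℕ.>-nonZero (ℕ.≤-trans (s≤s z≤n) 4k²<n)}} (ℕ.<⇒≤ 4k²<n)) ⟩
        3 * 8 ^ n            ≡⟨ cong (3 *_) (length-admissibleMatrices n) ⟨
        3 * l                <⟨ ℕ.*-monoˡ-< l {{l≢0}} (ℕ.n<1+n 3) ⟩
        4 * l                ∎))
      where
      open ℕ.≤-Reasoning

      g l d : ℕ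
      g = length (filter (P? n) (admissibleMatrices n))
      l = length (admissibleMatrices n)
      d = steps n δ₀ 0

      l≢0 : NonZero l
      l≢0 = admissibleMatrices-nonZero n

      swap : ∀ k d → k * (3 * d) ≡ 3 * (k * d)
      swap = solve-∀

theorem4p2 : (B : Graph 4) → Regular B → (C : ∀ n → Graph n) →
    ((∀ n → 1 < n → MinDegree≥ 1 (C n)) →
    (λ n → proportionOfAdmissible n λ N →
    Z (cone (block B N (C n))) ≉? Z (cone (block B (switch N) (C n))))
    TendsTo 1ℚ)
    ×
    ((∀ n → 2 < n → MinDegree≥ 2 (C n)) →
    (λ n → proportionOfAdmissible n λ N →
    Z (block B N (C n)) ≉? Z (block B (switch N) (C n)))
    TendsTo 1ℚ)
theorem4p2 B (r , regular) C = coneCase , plainCase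
  where
  coneCase : (∀ n → 1 < n → MinDegree≥ 1 (C n)) →
    (λ n → proportionOfAdmissible n λ N →
    Z (cone (block B N (C n))) ≉? Z (cone (block B (switch N) (C n)))) TendsTo 1ℚ
  -- The threshold is 2 because `1 < n` unfolds to `2 ≤ n`; likewise 3 in the plain case.
  coneCase minDegree = proportion-tendsTo-1
    (λ n N → Z (cone (block B N (C n))) ≉? Z (cone (block B (switch N) (C n)))) 2
    λ n 2≤n N admissible ¬≉ → Z-cone≈⇒coincidence B regular (C n) (minDegree n 2≤n) N admissible
      (decidable-stable (Z (cone (block B N (C n))) ≈? Z (cone (block B (switch N) (C n)))) ¬≉)

  plainCase : (∀ n → 2 < n → MinDegree≥ 2 (C n)) →
    (λ n → proportionOfAdmissible n λ N →
    Z (block B N (C n)) ≉? Z (block B (switch N) (C n))) TendsTo 1ℚ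
  plainCase minDegree = proportion-tendsTo-1
    (λ n N → Z (block B N (C n)) ≉? Z (block B (switch N) (C n))) 3
    λ n 3≤n N admissible ¬≉ → Z≈⇒coincidence B regular (C n) (minDegree n 3≤n) N admissible
      (decidable-stable (Z (block B N (C n)) ≈? Z (block B (switch N) (C n))) ¬≉)
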